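{- Let $I$ be an independent set in a claw-free graph $G$. Let $C=c_0,c_1,\dots,c_{2n-1},c_{0}$ be an $I$-bad cycle ($c_0\in I$) with $I$-bipartition $[A,B]$, of length at least 8. Then $C$ is internally resolvable if and only if $D(G,C)$ or $D(G,C^{rev})$ contains a directed path from a vertex $b\in N_1(B)$ with $N(b)\cap I\subseteq A$ to a vertex in $A$.
   Context: A claw is the tree with four vertices and three leaves; a graph is claw-free if it has no induced claw. For $S\subseteq V(G)$ and integer $i$, $N_i(S)=\{v\in V(G)\setminus S : |N(v)\cap S|=i\}$. A walk $v_0,\dots,v_k$ is $I$-alternating if $|\{v_i,v_{i+1}\}\cap I|=1$ for all $i$. A cycle $v_0,\dots,v_k=v_0$ is chordless if $G[\{v_0,\dots,v_{k-1}\}]$ is a cycle. A cycle is $I$-bad if it is $I$-alternating and chordless. The $I$-bipartition of an $I$-bad cycle $C$ is the ordered pair $[V(C)\cap I, V(C)\setminus I]$. A move $u\to v$ (sliding a token from $u$ to $v$) transforms an independent set $I$ into $I-u+v$, where $uv\in E(G)$, $u\in I$, and the result is independent; a TS-sequence is a sequence of independent sets each obtained from the previous one by such a move. An $I$-bad cycle $C$ with $I$-bipartition $[A,B]$ is resolvable if there is a TS-sequence from $I$ to some independent set $I'$ such that $G[I'\cup B]$ has no cycles (a resolving sequence). A move $u\to v$ is internal if $\{u,v\}\subseteq N_2(B)$; a resolving sequence is internal if every move except the last is internal; $C$ is internally resolvable if an internal resolving sequence exists. Write $C=c_0,c_1,\ldots,c_{2n-1},c_0$ with $c_i\in I$ for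 even $i$. For $i\in\{0,\ldots,n-1\}$ the layer is $L_i=\{v\in V(G) : N(v)\cap B=N(c_{2i})\cap B\}$. For such a cycle of length at least 8, $D(G,C)$ is the digraph on vertex set $V(G)$ with arcs: for every $i\in\{0,\ldots,n-1\}$ and all $u\in L_i$, $v\in L_{(i+1)\bmod n}$ with $uv\notin E(G)$, an arc $(u,v)$; and for every $i\in\{0,\ldots,n-1\}$, every $b\in N_1(B)$ with $N(b)\cap B=\{c_{(2i-1)\bmod 2n}\}$, and every $v\in L_i$ with $bv\notin E(G)$, an arc $(b,v)$. $C^{rev}=c_0,c_{2n-1},\ldots,c_1,c_0$ is the reversed cycle, and $D(G,C^{rev})$ is defined in the same way using this reversed labelling (so arcs between layers are reversed, and arcs from $N_1(B)$ go to different layers). -}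

module Defs where

open import Level using (0ℓ)
open import Data.Nat using (ℕ; zero; suc; _+_; _*_; _∸_; _≤_; _<_; _%_)
open import Data.Fin using (Fin)
open import Data.Fin.Subset using (Subset; _∈_; _∉_; _⊆_; _∩_; _∪_; _─_; _-_; ⁅_⁆; ⋃; ∣_∣; inside; outside)
open import Data.Vec using (tabulate)
open import Data.List using (List; map; upTo)
open import Data.Product using (Σ; ∃; ∃-syntax; _×_; _,_)
open import Data.Sum using (_⊎_)
open import Relation.Nullary using (¬_; Dec; does)
open import Relation.Binary.PropositionalEquality using (_≡_; _≢_)
open import Relation.Binary.Construct.Closure.ReflexiveTransitive using (Star)

wrap : ℕ → ℕ → ℕ
wrap zero    i = 0
wrap (suc k) i = i % suc k

record Graph : Set₁ where
  field
    N      : ℕ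
    E      : Fin N → Fin N → Set
    E?     : (u v : Fin N) → Dec (E u v)
    sym    : ∀ {u v} → E u v → E v u
    irrefl : ∀ {u} → ¬ E u u

module _ (G : Graph) where
  open Graph G

  VSet : Set
  VSet = Subset N

  nbhd : Fin N → VSet
  nbhd v = tabulate (λ u → does (E? v u))

  ClawFree : Set
  ClawFree = ∀ x a b c → E x a → E x b → E x c →
             a ≢ b → a ≢ c → b ≢ c →
             ¬ E a b → ¬ E a c → ¬ E b c → Data.Empty.⊥
    where import Data.Empty

  Independent : VSet → Set
  Independent I = ∀ u v → u ∈ I → v ∈ I → ¬ E u v

  InN : ℕ → VSet → Fin N → Set
  InN i S v = v ∉ S × ∣ nbhd v ∩ S ∣ ≡ i


  IsCycle : ℕ → (ℕ → Fin N) → Set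
  IsCycle k f = 3 ≤ k
              × (∀ i j → i < k → j < k → f i ≡ f j → i ≡ j)
              × (∀ i → i < k → E (f i) (f (wrap k (suc i))))

  IsChordlessCycle : ℕ → (ℕ → Fin N) → Set
  IsChordlessCycle k f = IsCycle k f
              × (∀ i j → i < k → j < k → E (f i) (f j) →
                   (j ≡ wrap k (suc i)) ⊎ (i ≡ wrap k (suc j)))

  IsAlternating : VSet → ℕ → (ℕ → Fin N) → Set
  IsAlternating I k f = ∀ i → i < k →
       (f i ∈ I × f (wrap k (suc i)) ∉ I) ⊎ (f i ∉ I × f (wrap k (suc i)) ∈ I)

  IsBad : VSet → ℕ → (ℕ → Fin N) → Set
  IsBad I k f = IsAlternating I k f × IsChordlessCycle k f

  HasCycleIn : VSet → Set
  HasCycleIn S = ∃[ k ] ∃[ f ] (IsCycle k f × (∀ i → i < k → f i ∈ S))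

  cycleVerts : ℕ → (ℕ → Fin N) → VSet
  cycleVerts k c = ⋃ (map (λ i → ⁅ c i ⁆) (upTo k))

  partA : VSet → ℕ → (ℕ → Fin N) → VSet
  partA I k c = cycleVerts k c ∩ I

  partB : VSet → ℕ → (ℕ → Fin N) → VSet
  partB I k c = cycleVerts k c ─ I

  Move : VSet → VSet → Set
  Move I J = ∃[ u ] ∃[ v ] (E u v × u ∈ I × J ≡ ((I - u) ∪ ⁅ v ⁆) × Independent J)

  InternalMove : VSet → VSet → VSet → Set
  InternalMove B I J = ∃[ u ] ∃[ v ] (E u v × u ∈ I × J ≡ ((I - u) ∪ ⁅ v ⁆) × Independent J
                                      × InN 2 B u × InN 2 B v)

  -- C (given by c, length 2n) is internally resolvable: a TS-sequence from I to I'
  -- in which every move except the last is internal, with G[I' ∪ B] acyclic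
  InternallyResolvable : VSet → ℕ → (ℕ → Fin N) → Set
  InternallyResolvable I n c =
      (∃[ J ] (Star (InternalMove B) I J × ¬ HasCycleIn (J ∪ B)))
    ⊎ (∃[ J ] ∃[ K ] (Star (InternalMove B) I J × Move J K × ¬ HasCycleIn (K ∪ B)))
    where B = partB I (2 * n) c

  InLayer : VSet → ℕ → (ℕ → Fin N) → ℕ → Fin N → Set
  InLayer I n c i v = nbhd v ∩ B ≡ nbhd (c (2 * i)) ∩ B
    where B = partB I (2 * n) c

  Arc : VSet → ℕ → (ℕ → Fin N) → Fin N → Fin N → Set
  Arc I n c u v =
      (∃[ i ] (i < n × InLayer I n c i u × InLayer I n c (wrap n (suc i)) v × ¬ E u v))
    ⊎ (∃[ i ] (i < n × InN 1 B u
               × nbhd u ∩ B ≡ ⁅ c (wrap (2 * n) (2 * i + 2 * n ∸ 1)) ⁆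
               × InLayer I n c i v × ¬ E u v))
    where B = partB I (2 * n) c

  rev : ℕ → (ℕ → Fin N) → ℕ → Fin N
  rev n c j = c (wrap (2 * n) (2 * n ∸ j))

  -- D(G,C) contains a directed path from some b ∈ N_1(B) with N(b) ∩ I ⊆ A
  -- to a vertex of A (paths given as walks: reflexive-transitive closure of arcs)
  HasGoodPath : VSet → ℕ → (ℕ → Fin N) → (ℕ → Fin N) → Set
  HasGoodPath I n c d = ∃[ b ] ∃[ a ]
      (InN 1 B b × (nbhd b ∩ I) ⊆ A × a ∈ A × Star (Arc I n d) b a)
    where
      A = partA I (2 * n) c
      B = partB I (2 * n) c

{-# OPTIONS --safe #-}
module Submission where

-- Claw-freeness forces every set reached by internal moves to keep exactly one token in each
-- layer and to leave I \ A in place, and a last move resolves C exactly when it takes a token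
-- to a vertex b with a single neighbour in B.
--
-- If such a sequence exists: consecutive tokens are non-adjacent, hence joined by arcs, so when
-- a token moves to v the arc from v to the next token shows that v still reaches A; the same
-- holds for b, in one of the two directions.
--
-- Conversely, follow a walk from b to a token x.  If b misses one of its two candidate
-- tokens, the other one moves to b.  Otherwise look at the first walk vertex v, in layer i + 1
-- say, that is not adjacent to the token of layer i + 2.  Claws at the tokens passed before show
-- that v is adjacent to the token of its own layer only, so this token can move to v, and v
-- ends a strictly shorter walk from b.

open import Defs
open import Data.Empty using (⊥-elim)
open import Data.Fin using (Fin; zero; suc; _≟_; toℕ; fromℕ<)
open import Data.Fin.Properties using (toℕ-fromℕ<; toℕ-injective; toℕ<n)
open import Data.Fin.Subset using (Subset; _∈_; _∉_; _⊆_; _∩_; _∪_; _─_; _-_; ⁅_⁆; ⋃; ∣_∣; inside; outside; Empty)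
open import Data.Fin.Subset.Properties
open import Data.List as List using ([]; _∷_)
open import Data.List.Membership.Propositional using () renaming (_∈_ to _∈ₗ_)
open import Data.List.Membership.Propositional.Properties using (∈-upTo⁺; ∈-upTo⁻)
open import Data.List.Relation.Unary.Any using (here; there)
open import Data.Nat using (ℕ; zero; suc; _+_; _∸_; _≤_; _<_; _*_; z≤n; s≤s)
open import Data.Nat.DivMod using (m<n⇒m%n≡m; n%n≡0; [m+n]%n≡m%n; m%n<n)
import Data.Nat.Properties as ℕₚ
open import Data.Product using (∃; _×_; _,_; proj₁; proj₂)
open import Data.Sum using (_⊎_; inj₁; inj₂; [_,_]′)
open import Data.Vec using (_∷_; here; there)
open import Data.Vec.Properties using (lookup∘tabulate; lookup⇒[]=; []=⇒lookup)
open import Function using (_∘_; id)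
open import Function.Bundles using (_⇔_; mk⇔)
open import Relation.Nullary using (¬_; yes; no; does)
open import Relation.Nullary.Decidable using (dec-true)
open import Relation.Binary.PropositionalEquality using (_≡_; _≢_; refl; sym; trans; cong; subst; subst₂)
open import Relation.Binary.Construct.Closure.ReflexiveTransitive as Star using (Star; ε; _◅_)

-- Finite subsets.

x∈p─q⇒x∉q : ∀ {n} {x : Fin n} (p q : Subset n) → x ∈ p ─ q → x ∉ q
x∈p─q⇒x∉q (_ ∷ p) (inside ∷ q)  (there x∈p─q) (there x∈q) = x∈p─q⇒x∉q p q x∈p─q x∈q
x∈p─q⇒x∉q (_ ∷ p) (outside ∷ q) (there x∈p─q) (there x∈q) = x∈p─q⇒x∉q p q x∈p─q x∈q

∣⁅x⁆∪⁅y⁆∣≡2 : ∀ {n} {x y : Fin n} → x ≢ y → ∣ ⁅ x ⁆ ∪ ⁅ y ⁆ ∣ ≡ 2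
∣⁅x⁆∪⁅y⁆∣≡2 {x = zero}  {zero}  x≢y = ⊥-elim (x≢y refl)
∣⁅x⁆∪⁅y⁆∣≡2 {x = zero}  {suc y} x≢y =
  cong suc (trans (cong ∣_∣ (∪-identityˡ ⁅ y ⁆)) (∣⁅x⁆∣≡1 y))
∣⁅x⁆∪⁅y⁆∣≡2 {x = suc x} {zero}  x≢y =
  cong suc (trans (cong ∣_∣ (∪-identityʳ ⁅ x ⁆)) (∣⁅x⁆∣≡1 x))
∣⁅x⁆∪⁅y⁆∣≡2 {x = suc x} {suc y} x≢y = ∣⁅x⁆∪⁅y⁆∣≡2 (x≢y ∘ cong suc)

-- If `x` were missing, `p` would lie inside `⁅ y ⁆`, which has size one.
∣p∣≡2∧p⊆xy⇒x∈p : ∀ {n} {p : Subset n} {x y} → ∣ p ∣ ≡ 2 →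
                 (∀ {z} → z ∈ p → z ≡ x ⊎ z ≡ y) → x ∈ p
∣p∣≡2∧p⊆xy⇒x∈p {p = p} {x} {y} ∣p∣≡2 p⊆xy with x ∈? p
... | yes x∈p = x∈p
... | no  x∉p with subst₂ _≤_ ∣p∣≡2 (∣⁅x⁆∣≡1 y) (p⊆q⇒∣p∣≤∣q∣ p⊆y)
  where
  p⊆y : p ⊆ ⁅ y ⁆
  p⊆y z∈p with p⊆xy z∈p
  ... | inj₁ refl = ⊥-elim (x∉p z∈p)
  ... | inj₂ refl = x∈⁅x⁆ y
... | s≤s ()

-- Cyclic successors and the arithmetic of even and odd positions.

wrap-small : ∀ {k i} → i < k → wrap k i ≡ i
wrap-small {suc k} i<k = m<n⇒m%n≡m i<k

wrap-self : ∀ k → wrap k k ≡ 0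
wrap-self zero    = refl
wrap-self (suc k) = n%n≡0 (suc k)

wrap-+ : ∀ {k i} → i < k → wrap k (i + k) ≡ i
wrap-+ {suc k} {i} i<k = trans ([m+n]%n≡m%n i (suc k)) (m<n⇒m%n≡m i<k)

wrap-< : ∀ {k} → 0 < k → ∀ i → wrap k i < k
wrap-< {suc k} _ i = m%n<n i (suc k)

-- The graph of `i ↦ wrap k (suc i)` on indices below `k`, split so that pattern matching separates
-- the ordinary step from the step around the end.
data Succ (k i : ℕ) : ℕ → Set where
  up     : suc i < k → Succ k i (suc i)
  around : suc i ≡ k → Succ k i 0

wrap-suc : ∀ {k i} → i < k → Succ k i (wrap k (suc i))
wrap-suc {k} {i} i<k with ℕₚ.m≤n⇒m<n∨m≡n i<k
... | inj₁ si<k = subst (Succ k i) (sym (wrap-small si<k)) (up si<k)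
... | inj₂ refl = subst (Succ k i) (sym (wrap-self (suc i))) (around refl)

-- The only collision would be in a cycle of length two. This separates the two neighbours of a
-- position on a cycle.
Succ-suc≢ : ∀ {k j w} → 3 ≤ k → Succ k (suc j) w → w ≢ j
Succ-suc≢ _   (up _)        ()
Succ-suc≢ 3≤2 (around refl) refl = ℕₚ.<-irrefl refl 3≤2

double-suc : ∀ m → 2 * suc m ≡ suc (suc (2 * m))
double-suc = ℕₚ.*-suc 2

half : ∀ j → ∃ λ m → j ≡ 2 * m ⊎ j ≡ suc (2 * m)
half zero = 0 , inj₁ refl
half (suc j) with half j
... | m , inj₁ refl = m , inj₂ refl
... | m , inj₂ refl = suc m , inj₁ (sym (double-suc m))

double-injective : ∀ {i j} → 2 * i ≡ 2 * j → i ≡ j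
double-injective {i} {j} = ℕₚ.*-cancelˡ-≡ i j 2

double-< : ∀ {i n} → i < n → 2 * i < 2 * n
double-< = ℕₚ.*-monoʳ-< 2

double-<⁻ : ∀ {i n} → 2 * i < 2 * n → i < n
double-<⁻ {i} {n} = ℕₚ.*-cancelˡ-< 2 i n

suc-double-< : ∀ {i n} → i < n → suc (2 * i) < 2 * n
suc-double-< {i} {n} i<n = subst (_≤ 2 * n) (double-suc i) (ℕₚ.*-monoʳ-≤ 2 i<n)

Succ-functional : ∀ {k i j j′} → Succ k i j → Succ k i j′ → j ≡ j′
Succ-functional (up _)      (up _)      = refl
Succ-functional (up si<k)   (around eq) = ⊥-elim (ℕₚ.<-irrefl eq si<k)
Succ-functional (around eq) (up si<k)   = ⊥-elim (ℕₚ.<-irrefl eq si<k)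
Succ-functional (around _)  (around _)  = refl

Succ-injective : ∀ {k i i′ j} → Succ k i j → Succ k i′ j → i ≡ i′
Succ-injective (up _)      (up _)       = refl
Succ-injective (around eq) (around eq′) = ℕₚ.suc-injective (trans eq (sym eq′))

-- Closing up after one, two or three steps would force `k` to be at most three. These three lemmas
-- turn the bound on the length of `C` into distinctness of nearby layers.
Succ-irrefl : ∀ {k i} → 4 ≤ k → ¬ Succ k i i
Succ-irrefl 4≤1 (around refl) = ℕₚ.<⇒≱ 4≤1 (s≤s z≤n)

Succ²-irrefl : ∀ {k i j} → 4 ≤ k → Succ k i j → ¬ Succ k j i
Succ²-irrefl 4≤2 (up _)        (around refl) = ℕₚ.<⇒≱ 4≤2 (s≤s (s≤s z≤n))
Succ²-irrefl 4≤2 (around refl) (up _)        = ℕₚ.<⇒≱ 4≤2 (s≤s (s≤s z≤n))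
Succ²-irrefl 4≤1 (around refl) (around _)    = ℕₚ.<⇒≱ 4≤1 (s≤s z≤n)

Succ³-irrefl : ∀ {k i j l} → 4 ≤ k → Succ k i j → Succ k j l → ¬ Succ k l i
Succ³-irrefl 4≤3 (up _)        (up _)        (around refl) = ℕₚ.<⇒≱ 4≤3 (s≤s (s≤s (s≤s z≤n)))
Succ³-irrefl 4≤3 (up _)        (around refl) (up _)        = ℕₚ.<⇒≱ 4≤3 (s≤s (s≤s (s≤s z≤n)))
Succ³-irrefl 4≤3 (around refl) (up _)        (up _)        = ℕₚ.<⇒≱ 4≤3 (s≤s (s≤s (s≤s z≤n)))
Succ³-irrefl 4≤1 (around _)    (around refl) (around refl) = ℕₚ.<⇒≱ 4≤1 (s≤s z≤n)

Succ-double : ∀ {n i j} → Succ n i j → wrap (2 * n) (suc (suc (2 * i))) ≡ 2 * j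
Succ-double {n} {i} {j} s = subst (λ m → wrap (2 * n) m ≡ 2 * j) (double-suc i) (lemma s)
  where
  lemma : ∀ {j} → Succ n i j → wrap (2 * n) (2 * suc i) ≡ 2 * j
  lemma (up si<n)     = wrap-small (double-< si<n)
  lemma (around refl) = wrap-self (2 * suc i)

-- The index is 2j - 1 modulo 2n, with 2n added first so that truncated subtraction is exact at j =
-- 0. Hence `wrap` has to reduce in the case `up`, but not in the case `around`.
Succ-double-pred : ∀ {n i j} → i < n → Succ n i j → wrap (2 * n) (2 * j + 2 * n ∸ 1) ≡ suc (2 * i)
Succ-double-pred {n} {i} i<n (up _) =
  trans (cong (λ m → wrap (2 * n) (m + 2 * n ∸ 1)) (double-suc i)) (wrap-+ (suc-double-< i<n))
Succ-double-pred {n} {i} i<n (around refl) =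
  trans (cong (λ m → wrap (2 * n) (m ∸ 1)) (double-suc i)) (wrap-small (suc-double-< i<n))

-- Reflection of indices.

∸-suc-< : ∀ {i n} → i < n → n ∸ suc i < n
∸-suc-< {i} (s≤s {n = n} _) = s≤s (ℕₚ.m∸n≤m n i)

-- Negation modulo `k`. With `k = 2 * n` it is the relabelling inside `rev`; with `k = n` it is the
-- induced relabelling of the layers.
reflect : ℕ → ℕ → ℕ
reflect k j = wrap k (k ∸ j)

reflect-suc : ∀ {k j} → suc j < k → reflect k (suc j) ≡ k ∸ suc j
reflect-suc sj<k = wrap-small (∸-suc-< (ℕₚ.<⇒≤ sj<k))

reflect-involutive : ∀ {k j} → j < k → reflect k (reflect k j) ≡ j
reflect-involutive {k} {zero} _ = trans (cong (λ m → wrap k (k ∸ m)) (wrap-self k)) (wrap-self k)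
reflect-involutive {k} {suc j} sj<k =
  trans (cong (λ m → wrap k (k ∸ m)) (reflect-suc sj<k))
  (trans (cong (wrap k) (ℕₚ.m∸[m∸n]≡n (ℕₚ.<⇒≤ sj<k))) (wrap-small sj<k))

reflect-Succ : ∀ {k i j} → 4 ≤ k → Succ k i j → Succ k (reflect k j) (reflect k i)
reflect-Succ {k} {zero} 4≤k (up 1<k) rewrite wrap-self k | reflect-suc 1<k =
  around (ℕₚ.m+[n∸m]≡n (ℕₚ.<⇒≤ 1<k))
reflect-Succ {k} {suc i} 4≤k (up ssi<k)
  rewrite reflect-suc ssi<k | reflect-suc (ℕₚ.<-trans (ℕₚ.n<1+n _) ssi<k) =
  subst (Succ k (k ∸ suc (suc i))) eq (up (subst (_< k) (sym eq) (∸-suc-< (ℕₚ.<⇒≤ (ℕₚ.<⇒≤ ssi<k)))))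
  where
  eq : suc (k ∸ suc (suc i)) ≡ k ∸ suc i
  eq = sym (ℕₚ.+-∸-assoc 1 (ℕₚ.<⇒≤ ssi<k))
reflect-Succ {i = zero} (s≤s ()) (around refl)
reflect-Succ {k} {suc i} 4≤k (around refl)
  rewrite wrap-self k | reflect-suc (ℕₚ.n<1+n (suc i)) | ℕₚ.m+n∸n≡m 1 i =
  up (s≤s (s≤s z≤n))

reflect-double : ∀ {n i} → i < n → reflect (2 * n) (2 * i) ≡ 2 * reflect n i
reflect-double {n} {zero} _ = trans (wrap-self (2 * n)) (cong (2 *_) (sym (wrap-self n)))
reflect-double {n} {suc i} si<n =
  trans (cong (wrap (2 * n)) (sym (ℕₚ.*-distribˡ-∸ 2 n (suc i))))
  (trans (wrap-small (double-< (∸-suc-< (ℕₚ.<⇒≤ si<n)))) (cong (2 *_) (sym (reflect-suc si<n))))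

-- Modulo 2n, -(2i + 1) = 2(-(i + 1)) + 1. The odd position after layer i thus goes to the one after
-- the reflection of layer i + 1, which is why `j` and not `i` appears on the right.
reflect-double-pred : ∀ {n i j} → i < n → Succ n i j → reflect (2 * n) (suc (2 * i)) ≡ suc (2 * reflect n j)
reflect-double-pred {n} {i} {j} i<n s =
  trans (cong (wrap (2 * n)) eq)
  (trans (wrap-small (suc-double-< (∸-suc-< i<n))) (cong (λ m → suc (2 * m)) (sym (at s))))
  where
  at : ∀ {j} → Succ n i j → reflect n j ≡ n ∸ suc i
  at (up si<n)     = reflect-suc si<n
  at (around refl) = trans (wrap-self (suc i)) (sym (ℕₚ.n∸n≡0 (suc i)))
  eq : 2 * n ∸ suc (2 * i) ≡ suc (2 * (n ∸ suc i))
  eq = trans (ℕₚ.+-∸-assoc 1 (suc-double-< i<n))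
       (cong suc (trans (cong (2 * n ∸_) (sym (double-suc i))) (sym (ℕₚ.*-distribˡ-∸ 2 n (suc i)))))

-- Interleaved sequences and unions over lists.

interleave : {X : Set} → (ℕ → X) → (ℕ → X) → ℕ → X
interleave f g zero          = f 0
interleave f g (suc zero)    = g 0
interleave f g (suc (suc j)) = interleave (f ∘ suc) (g ∘ suc) j

interleave-even : ∀ {X} (f g : ℕ → X) m → interleave f g (2 * m) ≡ f m
interleave-even f g zero    = refl
interleave-even f g (suc m) =
  trans (cong (interleave f g) (double-suc m)) (interleave-even (f ∘ suc) (g ∘ suc) m)

interleave-odd : ∀ {X} (f g : ℕ → X) m → interleave f g (suc (2 * m)) ≡ g m
interleave-odd f g zero    = refl
interleave-odd f g (suc m) =
  trans (cong (interleave f g ∘ suc) (double-suc m)) (interleave-odd (f ∘ suc) (g ∘ suc) m)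

∈-⋃-map⁺ : ∀ {m} {X : Set} (f : X → Subset m) {v x xs} → x ∈ₗ xs → v ∈ f x → v ∈ ⋃ (List.map f xs)
∈-⋃-map⁺ f (here refl)  v∈ = x∈p∪q⁺ (inj₁ v∈)
∈-⋃-map⁺ f (there x∈xs) v∈ = x∈p∪q⁺ (inj₂ (∈-⋃-map⁺ f x∈xs v∈))

∈-⋃-map⁻ : ∀ {m} {X : Set} (f : X → Subset m) {v} xs → v ∈ ⋃ (List.map f xs) → ∃ λ x → x ∈ₗ xs × v ∈ f x
∈-⋃-map⁻ f []       v∈ = ⊥-elim (∉⊥ v∈)
∈-⋃-map⁻ f (x ∷ xs) v∈ with x∈p∪q⁻ (f x) _ v∈
... | inj₁ v∈x = x , here refl , v∈x
... | inj₂ v∈xs with ∈-⋃-map⁻ f xs v∈xs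
...   | y , y∈xs , v∈y = y , there y∈xs , v∈y

-- Neighbourhoods, cycles and the effect of a single move.

module Tokens (G : Graph) where
  open Graph G using (E; E?; irrefl) renaming (N to order; sym to E-sym) public

  V : Set
  V = Fin order

  E⇒∈nbhd : ∀ {v w} → E v w → w ∈ nbhd G v
  E⇒∈nbhd {v} {w} vw = lookup⇒[]= w _
    (trans (lookup∘tabulate (λ u → does (E? v u)) w) (dec-true (E? v w) vw))

  ∈nbhd⇒E : ∀ {v w} → w ∈ nbhd G v → E v w
  ∈nbhd⇒E {v} {w} w∈ with E? v w
    | trans (sym (lookup∘tabulate (λ u → does (E? v u)) w)) ([]=⇒lookup w∈)
  ... | yes vw | _ = vw
  ... | no  _  | ()

  -- Acyclicity is later derived from this degree condition on the vertices of a cycle. Position 0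
  -- is treated apart because its predecessor is the last position.
  cycle-nbrs : ∀ {k f} → IsCycle G k f → ∀ j → j < k →
               ∃ λ j₁ → ∃ λ j₂ → j₁ < k × j₂ < k × f j₁ ≢ f j₂ × E (f j) (f j₁) × E (f j) (f j₂)
  cycle-nbrs {suc k} {f} (3≤k , inj , edge) zero _ =
    1 , k , ℕₚ.≤-trans (s≤s (s≤s z≤n)) 3≤k , ℕₚ.n<1+n k
    , (λ eq → ℕₚ.<-irrefl (inj 1 k (ℕₚ.≤-trans (s≤s (s≤s z≤n)) 3≤k) (ℕₚ.n<1+n k) eq) (ℕₚ.≤-pred 3≤k))
    , subst (E (f 0) ∘ f) (wrap-small (ℕₚ.≤-trans (s≤s (s≤s z≤n)) 3≤k)) (edge 0 (s≤s z≤n))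
    , E-sym (subst (E (f k) ∘ f) (wrap-self (suc k)) (edge k (ℕₚ.n<1+n k)))
  cycle-nbrs {k} {f} (3≤k , inj , edge) (suc j) sj<k =
    wrap k (suc (suc j)) , j , w<k , j<k
    , (λ eq → Succ-suc≢ 3≤k (wrap-suc sj<k) (inj _ j w<k j<k eq))
    , edge (suc j) sj<k
    , E-sym (subst (E (f j) ∘ f) (wrap-small sj<k) (edge j j<k))
    where
    j<k : j < k
    j<k = ℕₚ.<-trans (ℕₚ.n<1+n j) sj<k
    w<k : wrap k (suc (suc j)) < k
    w<k = wrap-< (ℕₚ.≤-trans (s≤s z≤n) 3≤k) (suc (suc j))

  swap : VSet G → V → V → VSet G
  swap J u v = (J - u) ∪ ⁅ v ⁆

  ∈-swap⁻ : ∀ J u v {y} → y ∈ swap J u v → (y ∈ J × y ≢ u) ⊎ y ≡ v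
  ∈-swap⁻ J u v y∈ with x∈p∪q⁻ (J - u) ⁅ v ⁆ y∈
  ... | inj₁ y∈J-u = inj₁ (p─q⊆p J ⁅ u ⁆ y∈J-u , x∉⁅y⁆⇒x≢y (x∈p─q⇒x∉q J ⁅ u ⁆ y∈J-u))
  ... | inj₂ y∈v = inj₂ (x∈⁅y⁆⇒x≡y v y∈v)

  ∈-swap-old : ∀ {J u v y} → y ∈ J → y ≢ u → y ∈ swap J u v
  ∈-swap-old y∈J y≢u = x∈p∪q⁺ (inj₁ (x∈p∧x≢y⇒x∈p-y y∈J y≢u))

  ∈-swap-new : ∀ {J u v} → v ∈ swap J u v
  ∈-swap-new {v = v} = x∈p∪q⁺ (inj₂ (x∈⁅x⁆ v))

  swap-independent : ∀ {J u v} → Independent G J → (∀ {y} → y ∈ J → y ≢ u → ¬ E v y) →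
                     Independent G (swap J u v)
  swap-independent {J} {u} {v} ind v≁ y z y∈ z∈ yz with ∈-swap⁻ J u v y∈ | ∈-swap⁻ J u v z∈
  ... | inj₁ (y∈J , _)   | inj₁ (z∈J , _)   = ind y z y∈J z∈J yz
  ... | inj₁ (y∈J , y≢u) | inj₂ refl        = v≁ y∈J y≢u (E-sym yz)
  ... | inj₂ refl        | inj₁ (z∈J , z≢u) = v≁ z∈J z≢u yz
  ... | inj₂ refl        | inj₂ refl        = irrefl yz

  -- Layers in cyclic order, independent of the numbering of the cycle.

  module Setting (claw-free : ClawFree G)
                 (I A B : VSet G) (I-independent : Independent G I)
                 (B-independent : Independent G B)
                 (I∩B≡∅ : ∀ {v} → v ∈ I → v ∉ B) (A⊆I : A ⊆ I)
                 {n : ℕ} (a : Fin n → V)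
                 (a∈A : ∀ i → a i ∈ A) (A⊆a : ∀ {v} → v ∈ A → ∃ λ i → v ≡ a i)
                 where

    Layer : Fin n → V → Set
    Layer i v = nbhd G v ∩ B ≡ nbhd G (a i) ∩ B

    -- One token in every layer closes a cycle through `B`, so no such position resolves `C`. It is
    -- kept as a hypothesis until the numbering of the cycle is available.
    LayersCyclic : Set
    LayersCyclic = ∀ {K : VSet G} (x : Fin n → V) → (∀ i → Layer i (x i)) → (∀ i → x i ∈ K) →
                   HasCycleIn G (K ∪ B)

    Pendant : V → V → Set
    Pendant w b = InN G 1 B b × nbhd G b ∩ B ≡ ⁅ w ⁆

    -- a i is the paper's c_{2i} and γ i its c_{2i+1}, so that the vertices of layer i
    -- see γ (prev i) and γ i in B; reversing the cycle exchanges next with prev and γ with γ ∘ prev.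
    record Frame : Set₁ where
      field
        next prev    : Fin n → Fin n
        next-prev    : ∀ i → next (prev i) ≡ i
        prev-next    : ∀ i → prev (next i) ≡ i
        next≢        : ∀ i → next i ≢ i
        next²≢       : ∀ i → next (next i) ≢ i
        next³≢       : ∀ i → next (next (next i)) ≢ i
        connected    : (P : Fin n → Set) → (∀ i → P i → P (next i)) → ∀ i j → P i → P j
        γ            : Fin n → V
        γ-injective  : ∀ {i j} → γ i ≡ γ j → i ≡ j
        γ∈B          : ∀ i → γ i ∈ B
        B⊆γ          : ∀ {v} → v ∈ B → ∃ λ i → v ≡ γ i
        a~γ          : ∀ i → E (a i) (γ i)
        a~γ-prev     : ∀ i → E (a i) (γ (prev i))
        a~γ-only     : ∀ {i j} → E (a i) (γ j) → j ≡ i ⊎ j ≡ prev i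

      prev-injective : ∀ {i j} → prev i ≡ prev j → i ≡ j
      prev-injective {i} {j} eq = trans (sym (next-prev i)) (trans (cong next eq) (next-prev j))

      next-injective : ∀ {i j} → next i ≡ next j → i ≡ j
      next-injective {i} {j} eq = trans (sym (prev-next i)) (trans (cong prev eq) (prev-next j))

      prev≡⇒≡next : ∀ {i j} → prev i ≡ j → i ≡ next j
      prev≡⇒≡next {i} eq = trans (sym (next-prev i)) (cong next eq)

      ≡prev⇒next≡ : ∀ {i j} → i ≡ prev j → next i ≡ j
      ≡prev⇒next≡ {j = j} eq = trans (cong next eq) (next-prev j)

      prev≢ : ∀ i → prev i ≢ i
      prev≢ i eq = next≢ i (sym (prev≡⇒≡next eq))

    reverse : Frame → Frame
    reverse F = record
      { next = prev ; prev = next ; next-prev = prev-next ; prev-next = next-prev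
      ; next≢ = prev≢
      ; next²≢ = λ i eq → next²≢ i (sym (prev≡⇒≡next (prev≡⇒≡next eq)))
      ; next³≢ = λ i eq → next³≢ i (sym (prev≡⇒≡next (prev≡⇒≡next (prev≡⇒≡next eq))))
      -- Spreading along `prev` is obtained from spreading along `next` for the property
      -- `P k → P j`, which `next` preserves and which holds at `j` by `id`.
      ; connected = λ P step i j → connected (λ k → P k → P j)
          (λ k h Pnk → h (subst P (prev-next k) (step (next k) Pnk))) j i id
      ; γ = γ ∘ prev
      ; γ-injective = prev-injective ∘ γ-injective
      ; γ∈B = λ i → γ∈B (prev i)
      ; B⊆γ = λ v∈B → let (i , eq) = B⊆γ v∈B in
                       next i , trans eq (cong γ (sym (prev-next i)))
      ; a~γ = a~γ-prev
      ; a~γ-prev = λ i → subst (λ j → E (a i) (γ j)) (sym (prev-next i)) (a~γ i)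
      ; a~γ-only = [ inj₂ ∘ prev≡⇒≡next , inj₁ ∘ prev-injective ]′ ∘ a~γ-only
      }
      where open Frame F

    -- Members of I outside A never move; this is the position of all other tokens.
    record Position (J : VSet G) : Set where
      field
        x           : Fin n → V
        x∈layer     : ∀ i → Layer i (x i)
        x∈J         : ∀ i → x i ∈ J
        cover       : ∀ {y} → y ∈ J → (∃ λ i → y ≡ x i) ⊎ (y ∈ I × y ∉ A)
        fixed       : ∀ {y} → y ∈ I → y ∉ A → y ∈ J
        independent : Independent G J

    -- Adjacency between layers, `B`, pendant vertices and tokens outside `A`.

    module WithFrame (F : Frame) where
      open Frame F

      ∈N∩B : ∀ {v w} → E v w → w ∈ B → w ∈ nbhd G v ∩ B
      ∈N∩B vw w∈B = x∈p∩q⁺ (E⇒∈nbhd vw , w∈B)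

      N∩B-E : ∀ {v w} → w ∈ nbhd G v ∩ B → E v w
      N∩B-E {v} w∈ = ∈nbhd⇒E (proj₁ (x∈p∩q⁻ (nbhd G v) B w∈))

      transfer : ∀ {u v} → nbhd G u ∩ B ≡ nbhd G v ∩ B → ∀ {j} → E u (γ j) → E v (γ j)
      transfer eq {j} e = N∩B-E (subst (γ j ∈_) eq (∈N∩B e (γ∈B j)))

      layer~γ : ∀ {i v} → Layer i v → E v (γ i)
      layer~γ {i} l = transfer (sym l) (a~γ i)

      layer~γ-prev : ∀ {i v} → Layer i v → E v (γ (prev i))
      layer~γ-prev {i} l = transfer (sym l) (a~γ-prev i)

      layer~γ-only : ∀ {i j v} → Layer i v → E v (γ j) → j ≡ i ⊎ j ≡ prev i
      layer~γ-only l e = a~γ-only (transfer l e)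

      same-nbhd : ∀ {u v} → (∀ {j} → E u (γ j) → E v (γ j)) → nbhd G u ∩ B ⊆ nbhd G v ∩ B
      same-nbhd {u} {v} f w∈ with x∈p∩q⁻ (nbhd G u) B w∈
      ... | w∈u , w∈B with B⊆γ w∈B
      ... | j , refl = ∈N∩B (f (∈nbhd⇒E w∈u)) w∈B

      layer-intro : ∀ {i v} → E v (γ i) → E v (γ (prev i)) →
                    (∀ {j} → E v (γ j) → j ≡ i ⊎ j ≡ prev i) → Layer i v
      layer-intro {i} {v} e e′ only = ⊆-antisym (same-nbhd to) (same-nbhd from)
        where
        to : ∀ {j} → E v (γ j) → E (a i) (γ j)
        to f with only f
        ... | inj₁ refl = a~γ i
        ... | inj₂ refl = a~γ-prev i
        from : ∀ {j} → E (a i) (γ j) → E v (γ j)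
        from f with a~γ-only f
        ... | inj₁ refl = e
        ... | inj₂ refl = e′

      layer∉B : ∀ {i v} → Layer i v → v ∉ B
      layer∉B {i} l v∈B = B-independent _ _ v∈B (γ∈B i) (layer~γ l)

      -- The pair `γ i`, `γ (prev i)` determines `i`: a different index with the same pair would
      -- exchange the two and give `next (next i) ≡ i`.
      layer-unique : ∀ {i j v} → Layer i v → Layer j v → i ≡ j
      layer-unique {i} {j} l m with layer~γ-only m (layer~γ l) | layer~γ-only m (layer~γ-prev l)
      ... | inj₁ eq | _        = eq
      ... | inj₂ _  | inj₂ eq  = prev-injective eq
      ... | inj₂ eq | inj₁ eq′ = ⊥-elim (next²≢ i (sym (trans (prev≡⇒≡next eq′) (cong next (sym (≡prev⇒next≡ eq))))))

      layer-N₂ : ∀ {i v} → Layer i v → InN G 2 B v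
      layer-N₂ {i} {v} l = layer∉B l ,
        trans (cong ∣_∣ (⊆-antisym to from)) (∣⁅x⁆∪⁅y⁆∣≡2 (λ eq → prev≢ i (sym (γ-injective eq))))
        where
        to : nbhd G v ∩ B ⊆ ⁅ γ i ⁆ ∪ ⁅ γ (prev i) ⁆
        to w∈ with B⊆γ (p∩q⊆q (nbhd G v) B w∈)
        ... | j , refl with layer~γ-only l (N∩B-E w∈)
        ... | inj₁ refl = x∈p∪q⁺ (inj₁ (x∈⁅x⁆ _))
        ... | inj₂ refl = x∈p∪q⁺ (inj₂ (x∈⁅x⁆ _))
        from : ⁅ γ i ⁆ ∪ ⁅ γ (prev i) ⁆ ⊆ nbhd G v ∩ B
        from w∈ with x∈p∪q⁻ ⁅ γ i ⁆ ⁅ γ (prev i) ⁆ w∈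
        ... | inj₁ h with refl ← x∈⁅y⁆⇒x≡y _ h = ∈N∩B (layer~γ l) (γ∈B _)
        ... | inj₂ h with refl ← x∈⁅y⁆⇒x≡y _ h = ∈N∩B (layer~γ-prev l) (γ∈B _)

      -- Two neighbours in `B` and only two candidates for them: both candidates occur.
      N₂-layer : ∀ {i v} → InN G 2 B v → (∀ {j} → E v (γ j) → j ≡ i ⊎ j ≡ prev i) → Layer i v
      N₂-layer {i} {v} (_ , card) only = layer-intro
        (N∩B-E (∣p∣≡2∧p⊆xy⇒x∈p card both))
        (N∩B-E (∣p∣≡2∧p⊆xy⇒x∈p card ([ inj₂ , inj₁ ]′ ∘ both)))
        only
        where
        both : ∀ {z} → z ∈ nbhd G v ∩ B → z ≡ γ i ⊎ z ≡ γ (prev i)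
        both z∈ with B⊆γ (p∩q⊆q (nbhd G v) B z∈)
        ... | j , refl with only (N∩B-E z∈)
        ... | inj₁ refl = inj₁ refl
        ... | inj₂ refl = inj₂ refl

      layer-¬N₁ : ∀ {i v} → Layer i v → ¬ InN G 1 B v
      layer-¬N₁ l (_ , one) with trans (sym one) (proj₂ (layer-N₂ l))
      ... | ()

      pendant~γ : ∀ {i b} → Pendant (γ i) b → E b (γ i)
      pendant~γ (_ , eq) = N∩B-E (subst (_ ∈_) (sym eq) (x∈⁅x⁆ _))

      pendant~γ-only : ∀ {i j b} → Pendant (γ i) b → E b (γ j) → j ≡ i
      pendant~γ-only {j = j} (_ , eq) e = γ-injective (x∈⁅y⁆⇒x≡y _ (subst (γ j ∈_) eq (∈N∩B e (γ∈B j))))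

      pendant∉B : ∀ {i b} → Pendant (γ i) b → b ∉ B
      pendant∉B ((b∉B , _) , _) = b∉B

      pendant-intro : ∀ {i b} → b ∉ B → E b (γ i) → (∀ {j} → E b (γ j) → j ≡ i) → Pendant (γ i) b
      pendant-intro {i} {b} b∉B e only = (b∉B , trans (cong ∣_∣ eq) (∣⁅x⁆∣≡1 (γ i))) , eq
        where
        to : nbhd G b ∩ B ⊆ ⁅ γ i ⁆
        to w∈ with B⊆γ (p∩q⊆q (nbhd G b) B w∈)
        ... | j , refl with refl ← only (N∩B-E w∈) = x∈⁅x⁆ _
        from : ⁅ γ i ⁆ ⊆ nbhd G b ∩ B
        from w∈ with refl ← x∈⁅y⁆⇒x≡y _ w∈ = ∈N∩B e (γ∈B i)
        eq : nbhd G b ∩ B ≡ ⁅ γ i ⁆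
        eq = ⊆-antisym to from

      layer≢pendant : ∀ {i j v b} → Layer i v → Pendant (γ j) b → v ≢ b
      layer≢pendant l (N₁ , _) refl = layer-¬N₁ l N₁

      -- Otherwise v, γ i, γ (prev i) would be the leaves of a claw at u.
      layer-nbr : ∀ {i u v} → Layer i u → E u v → v ∉ B → E v (γ i) ⊎ E v (γ (prev i))
      layer-nbr {i} {u} {v} l uv v∉B with E? v (γ i) | E? v (γ (prev i))
      ... | yes e | _ = inj₁ e
      ... | no _ | yes e = inj₂ e
      ... | no ¬e | no ¬e′ = ⊥-elim (claw-free u v (γ i) (γ (prev i)) uv (layer~γ l) (layer~γ-prev l)
              (λ { refl → v∉B (γ∈B _) }) (λ { refl → v∉B (γ∈B _) })
              (λ eq → prev≢ i (sym (γ-injective eq))) ¬e ¬e′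
              (B-independent _ _ (γ∈B _) (γ∈B _)))

      -- By `layer-nbr` adjacent vertices of layers share a neighbour in `B`, and each `γ` is seen
      -- from just two consecutive layers.
      layers-nbr : ∀ {i j u v} → Layer i u → Layer j v → E u v → j ≡ i ⊎ j ≡ next i ⊎ i ≡ next j
      layers-nbr {i} {j} l m uv with layer-nbr l uv (layer∉B m)
      ... | inj₁ e with layer~γ-only m e
      ...   | inj₁ eq = inj₁ (sym eq)
      ...   | inj₂ eq = inj₂ (inj₁ (sym (≡prev⇒next≡ eq)))
      layers-nbr {i} {j} l m uv | inj₂ e with layer~γ-only m e
      ...   | inj₁ eq = inj₂ (inj₂ (prev≡⇒≡next eq))
      ...   | inj₂ eq = inj₁ (sym (prev-injective eq))

      pendant-nbr : ∀ {i j v b} → Layer i v → Pendant (γ j) b → E b v → i ≡ j ⊎ i ≡ next j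
      pendant-nbr {i} l P bv with layer-nbr l (E-sym bv) (pendant∉B P)
      ... | inj₁ e = inj₁ (pendant~γ-only P e)
      ... | inj₂ e = inj₂ (prev≡⇒≡next (pendant~γ-only P e))

      a-distinct : ∀ {i j} → i ≢ j → a i ≢ a j
      a-distinct {i} i≢j eq = i≢j (layer-unique {i} refl (cong (λ u → nbhd G u ∩ B) eq))

      a~γ-next : ∀ i → E (a (next i)) (γ i)
      a~γ-next i = subst (λ j → E (a (next i)) (γ j)) (prev-next i) (a~γ-prev (next i))

      -- Otherwise `a j`, `a (next j)` and `y`, all members of `I`, would be the leaves of a claw at
      -- `γ j`.
      fixed≁γ : ∀ {y j} → y ∈ I → y ∉ A → ¬ E y (γ j)
      fixed≁γ {y} {j} y∈I y∉A e = claw-free (γ j) (a j) (a (next j)) y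
        (E-sym (a~γ j)) (E-sym (a~γ-next j)) (E-sym e)
        (a-distinct (λ eq → next≢ j (sym eq)))
        (λ { refl → y∉A (a∈A _) }) (λ { refl → y∉A (a∈A _) })
        (I-independent _ _ (A⊆I (a∈A _)) (A⊆I (a∈A _)))
        (I-independent _ _ (A⊆I (a∈A _)) y∈I)
        (I-independent _ _ (A⊆I (a∈A _)) y∈I)

      -- By `layer-nbr` an edge would give `y` a neighbour in `B`, which `fixed≁γ` forbids.
      layer≁fixed : ∀ {i v y} → Layer i v → y ∈ I → y ∉ A → ¬ E v y
      layer≁fixed l y∈I y∉A e with layer-nbr l e (I∩B≡∅ y∈I)
      ... | inj₁ e′ = fixed≁γ y∈I y∉A e′
      ... | inj₂ e′ = fixed≁γ y∈I y∉A e′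

      layer≢fixed : ∀ {i v y} → Layer i v → y ∈ I → y ∉ A → v ≢ y
      layer≢fixed l y∈I y∉A refl = fixed≁γ y∈I y∉A (layer~γ l)

      initial : Position I
      initial = record
        { x = a ; x∈layer = λ _ → refl ; x∈J = λ i → A⊆I (a∈A i)
        ; cover = cov ; fixed = λ y∈I _ → y∈I ; independent = I-independent }
        where
        cov : ∀ {y} → y ∈ I → (∃ λ i → y ≡ a i) ⊎ (y ∈ I × y ∉ A)
        cov {y} y∈I with y ∈? A
        ... | yes y∈A = inj₁ (A⊆a y∈A)
        ... | no  y∉A = inj₂ (y∈I , y∉A)

      -- Moves from a position with one token per layer.

      module _ {J} (P : Position J) where
        open Position P

        x-injective : ∀ {i j} → x i ≡ x j → i ≡ j
        x-injective {i} {j} eq = layer-unique (x∈layer i) (subst (Layer j) (sym eq) (x∈layer j))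

        x~γ-next : ∀ i → E (x (next i)) (γ i)
        x~γ-next i = subst (λ j → E (x (next i)) (γ j)) (prev-next i) (layer~γ-prev (x∈layer (next i)))

        layer∩J : ∀ {i v} → Layer i v → v ∈ J → v ≡ x i
        layer∩J l v∈J with cover v∈J
        ... | inj₁ (j , refl) = cong x (layer-unique (x∈layer j) l)
        ... | inj₂ (v∈I , v∉A) = ⊥-elim (layer≢fixed l v∈I v∉A refl)

        -- The tokens `x i` and `x (next i)` are two non-adjacent neighbours of `γ i`, so by
        -- claw-freeness any further neighbour touches one of them.
        γ-nbr : ∀ {i y} → E y (γ i) → y ≡ x i ⊎ y ≡ x (next i) ⊎ E y (x i) ⊎ E y (x (next i))
        γ-nbr {i} {y} e with y ≟ x i | y ≟ x (next i) | E? y (x i) | E? y (x (next i))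
        ... | yes eq | _ | _ | _ = inj₁ eq
        ... | no _ | yes eq | _ | _ = inj₂ (inj₁ eq)
        ... | no _ | no _ | yes f | _ = inj₂ (inj₂ (inj₁ f))
        ... | no _ | no _ | no _ | yes f = inj₂ (inj₂ (inj₂ f))
        ... | no ≢₁ | no ≢₂ | no ≁₁ | no ≁₂ = ⊥-elim (claw-free (γ i) y (x i) (x (next i))
                (E-sym e) (E-sym (layer~γ (x∈layer i))) (E-sym (x~γ-next i))
                ≢₁ ≢₂ (λ eq → next≢ i (sym (x-injective eq)))
                ≁₁ ≁₂ (independent _ _ (x∈J i) (x∈J _)))

        move-layer : ∀ {i v} → Layer i v → Independent G (swap J (x i) v) → Position (swap J (x i) v)
        move-layer {i} {v} l ind = record
          { x = x′ ; x∈layer = x′∈layer ; x∈J = x′∈ ; cover = cov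
          ; fixed = λ y∈I y∉A → ∈-swap-old (fixed y∈I y∉A) (λ eq → layer≢fixed (x∈layer i) y∈I y∉A (sym eq))
          ; independent = ind }
          where
          x′ : Fin n → V
          x′ j with j ≟ i
          ... | yes _ = v
          ... | no _ = x j
          x′∈layer : ∀ j → Layer j (x′ j)
          x′∈layer j with j ≟ i
          ... | yes refl = l
          ... | no _ = x∈layer j
          x′∈ : ∀ j → x′ j ∈ swap J (x i) v
          x′∈ j with j ≟ i
          ... | yes _ = ∈-swap-new {J} {x i}
          ... | no j≢i = ∈-swap-old (x∈J j) (j≢i ∘ x-injective)
          x′-i : v ≡ x′ i
          x′-i with i ≟ i
          ... | yes _ = refl
          ... | no i≢i = ⊥-elim (i≢i refl)
          x′-j : ∀ {j} → j ≢ i → x j ≡ x′ j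
          x′-j {j} j≢i with j ≟ i
          ... | yes eq = ⊥-elim (j≢i eq)
          ... | no _ = refl
          cov : ∀ {y} → y ∈ swap J (x i) v → (∃ λ j → y ≡ x′ j) ⊎ (y ∈ I × y ∉ A)
          cov y∈ with ∈-swap⁻ J (x i) v y∈
          ... | inj₂ refl = inj₁ (i , x′-i)
          ... | inj₁ (y∈J , y≢) with cover y∈J
          ...   | inj₂ h = inj₂ h
          ...   | inj₁ (j , refl) = inj₁ (j , x′-j (λ { refl → y≢ refl }))

        -- Every γ j other than the two at layer i keeps both its tokens, so a third
        -- neighbour of it in the new independent set would create a claw.
        move-γ : ∀ {i v} → E (x i) v → Independent G (swap J (x i) v) →
                 ∀ {j} → E v (γ j) → j ≡ i ⊎ j ≡ prev i
        move-γ {i} {v} uv ind {j} e with γ-nbr e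
        ... | inj₁ refl = ⊥-elim (independent _ _ (x∈J i) (x∈J j) uv)
        ... | inj₂ (inj₁ refl) = ⊥-elim (independent _ _ (x∈J i) (x∈J (next j)) uv)
        ... | inj₂ (inj₂ (inj₁ f)) with j ≟ i
        ...   | yes eq = inj₁ eq
        ...   | no j≢i = ⊥-elim (ind v (x j) (∈-swap-new {J} {x i}) (∈-swap-old (x∈J j) (j≢i ∘ x-injective)) f)
        move-γ {i} {v} uv ind {j} e | inj₂ (inj₂ (inj₂ f)) with next j ≟ i
        ...   | yes eq = inj₂ (trans (sym (prev-next j)) (cong prev eq))
        ...   | no j≢i = ⊥-elim (ind v (x (next j)) (∈-swap-new {J} {x i})
                         (∈-swap-old (x∈J (next j)) (j≢i ∘ x-injective)) f)

        cyclic-layers : LayersCyclic → HasCycleIn G (J ∪ B)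
        cyclic-layers cycle = cycle x x∈layer x∈J

        -- A token outside `A` has no neighbour in `B`, so an internal move starts at some `x i`. By
        -- `move-γ` its target sees at most the two `γ` of layer `i`, and having two neighbours in
        -- `B` it sees both.
        internal-move : ∀ {J′} → InternalMove G B J J′ →
                        ∃ λ i → ∃ λ v → Layer i v × J′ ≡ swap J (x i) v × Independent G (swap J (x i) v)
        internal-move (u , v , uv , u∈J , refl , ind , (u∉B , u₂) , v₂) with cover u∈J
        ... | inj₁ (i , refl) = i , v , N₂-layer v₂ (move-γ uv ind) , refl , ind
        ... | inj₂ (u∈I , u∉A) = ⊥-elim (2≢0 (trans (sym u₂) (trans (cong ∣_∣ (Empty-unique empty)) (∣⊥∣≡0 order))))
          where
          2≢0 : 2 ≢ 0
          2≢0 ()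
          empty : Empty (nbhd G u ∩ B)
          empty (w , w∈) with B⊆γ (p∩q⊆q (nbhd G u) B w∈)
          ... | j , refl = fixed≁γ u∈I u∉A (N∩B-E w∈)

        -- A cycle avoids the pendant vertex b; since x k is gone, walking along the layers
        -- from k each next x and γ then has fewer than two neighbours left on it.
        acyclic : ∀ {i k b} → Pendant (γ i) b → Independent G (swap J (x k) b) →
                  ¬ HasCycleIn G (swap J (x k) b ∪ B)
        acyclic {i} {k} {b} Pb ind (len , f , cyc@(3≤len , _) , f∈) = no-start (S-cases S0)
          where
          K : VSet G
          K = swap J (x k) b

          S : V → Set
          S v = ∃ λ j → j < len × f j ≡ v

          S0 : S (f 0)
          S0 = 0 , ℕₚ.≤-trans (s≤s z≤n) 3≤len , refl

          S-nbrs : ∀ {v} → S v → ∃ λ u → ∃ λ w → S u × S w × u ≢ w × E v u × E v w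
          S-nbrs (j , j<len , refl) with cycle-nbrs cyc j j<len
          ... | j₁ , j₂ , l₁ , l₂ , ≢ , e₁ , e₂ =
            f j₁ , f j₂ , (j₁ , l₁ , refl) , (j₂ , l₂ , refl) , ≢ , e₁ , e₂

          S⊆ : ∀ {v} → S v → v ∈ K ⊎ v ∈ B
          S⊆ (j , j<len , refl) = x∈p∪q⁻ K B (f∈ j j<len)

          K-nbr : ∀ {v w} → v ∈ K → S w → E v w → ∃ λ j → w ≡ γ j
          K-nbr v∈K Sw vw with S⊆ Sw
          ... | inj₁ w∈K = ⊥-elim (ind _ _ v∈K w∈K vw)
          ... | inj₂ w∈B = B⊆γ w∈B

          ¬Sb : ¬ S b
          ¬Sb Sb with S-nbrs Sb
          ... | u , w , Su , Sw , u≢w , bu , bw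
            with K-nbr (∈-swap-new {J} {x k}) Su bu | K-nbr (∈-swap-new {J} {x k}) Sw bw
          ... | j , refl | l , refl = u≢w (cong γ (trans (pendant~γ-only Pb bu) (sym (pendant~γ-only Pb bw))))

          S-cases : ∀ {v} → S v → (∃ λ j → v ≡ x j × v ∈ K) ⊎ (∃ λ j → v ≡ γ j)
          S-cases Sv with S⊆ Sv
          ... | inj₂ v∈B = inj₂ (B⊆γ v∈B)
          ... | inj₁ v∈K with ∈-swap⁻ J (x k) b v∈K
          ...   | inj₂ refl = ⊥-elim (¬Sb Sv)
          ...   | inj₁ (v∈J , _) with cover v∈J
          ...     | inj₁ (j , eq) = inj₁ (j , eq , v∈K)
          ...     | inj₂ (v∈I , v∉A) with S-nbrs Sv
          ...       | u , _ , Su , _ , _ , vu , _ with K-nbr v∈K Su vu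
          ...         | j , refl = ⊥-elim (fixed≁γ v∈I v∉A vu)

          γ-nbrs : ∀ {j v} → S v → E (γ j) v → v ≡ x j ⊎ v ≡ x (next j)
          γ-nbrs {j} Sv e with S-cases Sv
          ... | inj₂ (l , refl) = ⊥-elim (B-independent _ _ (γ∈B j) (γ∈B l) e)
          ... | inj₁ (l , refl , _) with layer~γ-only (x∈layer l) (E-sym e)
          ...   | inj₁ refl = inj₁ refl
          ...   | inj₂ eq = inj₂ (cong x (sym (≡prev⇒next≡ eq)))

          x-nbrs : ∀ {j v} → S (x j) → S v → E (x j) v → v ≡ γ j ⊎ v ≡ γ (prev j)
          x-nbrs {j} Sx Sv e with S-cases Sv
          ... | inj₁ (l , refl , _) = ⊥-elim (independent _ _ (x∈J j) (x∈J l) e)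
          ... | inj₂ (l , refl) with layer~γ-only (x∈layer j) e
          ...   | inj₁ refl = inj₁ refl
          ...   | inj₂ refl = inj₂ refl

          -- Two distinct cycle neighbours drawn from two candidates exhaust them, so a chosen
          -- candidate lies on the cycle.
          pick : ∀ {u w y z} → S u → S w → u ≢ w → u ≡ y ⊎ u ≡ z → w ≡ y ⊎ w ≡ z → S z
          pick Su Sw u≢w (inj₂ refl) _           = Su
          pick Su Sw u≢w _           (inj₂ refl) = Sw
          pick Su Sw u≢w (inj₁ refl) (inj₁ refl) = ⊥-elim (u≢w refl)

          S-γ⇒S-x : ∀ {j} → S (γ j) → S (x j)
          S-γ⇒S-x Sγ with S-nbrs Sγ
          ... | u , w , Su , Sw , u≢w , e₁ , e₂ =
            pick Su Sw u≢w ([ inj₂ , inj₁ ]′ (γ-nbrs Su e₁)) ([ inj₂ , inj₁ ]′ (γ-nbrs Sw e₂))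

          S-x⇒S-γ-prev : ∀ {j} → S (x j) → S (γ (prev j))
          S-x⇒S-γ-prev Sx with S-nbrs Sx
          ... | u , w , Su , Sw , u≢w , e₁ , e₂ = pick Su Sw u≢w (x-nbrs Sx Su e₁) (x-nbrs Sx Sw e₂)

          ¬Sxk : ¬ S (x k)
          ¬Sxk Sx with S⊆ Sx
          ... | inj₂ x∈B = layer∉B (x∈layer k) x∈B
          ... | inj₁ x∈K with ∈-swap⁻ J (x k) b x∈K
          ...   | inj₁ (_ , x≢x) = x≢x refl
          ...   | inj₂ eq = layer≢pendant (x∈layer k) Pb eq

          ¬Sx : ∀ j → ¬ S (x j)
          ¬Sx j = connected (λ m → ¬ S (x m))
            (λ m ¬Sxm Sx → ¬Sxm (S-γ⇒S-x (subst (S ∘ γ) (prev-next m) (S-x⇒S-γ-prev Sx)))) k j ¬Sxk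

          no-start : ¬ ((∃ λ j → f 0 ≡ x j × f 0 ∈ K) ⊎ (∃ λ j → f 0 ≡ γ j))
          no-start (inj₁ (j , eq , _)) = ¬Sx j (subst S eq S0)
          no-start (inj₂ (j , eq)) = ¬Sx j (S-γ⇒S-x (subst S eq S0))

      -- The arcs of D(G,C), or of D(G,C^rev) when the frame is reversed, and their walks.

      Step : V → V → Set
      Step u v = (∃ λ i → Layer i u × Layer (next i) v × ¬ E u v)
               ⊎ (∃ λ i → Pendant (γ (prev i)) u × Layer i v × ¬ E u v)

      Reaches : V → Set
      Reaches u = ∃ λ t → t ∈ A × Star Step u t

      GoodPath : Set
      GoodPath = ∃ λ b → InN G 1 B b × (nbhd G b ∩ I) ⊆ A × Reaches b

      step-reaches : ∀ {u v} → Step u v → Reaches v → Reaches u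
      step-reaches uv (t , t∈A , path) = t , t∈A , uv ◅ path

      internal-moves : ∀ {J J′} → Star (InternalMove G B) J J′ →
                       Position J → (∀ {i u} → u ∈ J → Layer i u → Reaches u) →
                       Position J′ × (∀ {i u} → u ∈ J′ → Layer i u → Reaches u)
      internal-moves ε P reach = P , reach
      internal-moves {J} (move ◅ moves) P reach with internal-move P move
      ... | i , v , l , refl , ind = internal-moves moves (move-layer P l ind) reach′
        where
        open Position P
        reach′ : ∀ {j u} → u ∈ swap J (x i) v → Layer j u → Reaches u
        reach′ u∈ m with ∈-swap⁻ J (x i) v u∈
        ... | inj₁ (u∈J , _) = reach u∈J m
        ... | inj₂ refl = step-reaches
          (inj₁ (i , l , x∈layer (next i) ,
                 ind _ _ (∈-swap-new {J} {x i}) (∈-swap-old (x∈J (next i)) (next≢ i ∘ x-injective P))))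
          (reach (x∈J (next i)) (x∈layer (next i)))

      reached : ∀ {J} → Star (InternalMove G B) I J →
                Position J × (∀ {i u} → u ∈ J → Layer i u → Reaches u)
      reached moves = internal-moves moves initial in-A
        where
        in-A : ∀ {i u} → u ∈ I → Layer i u → Reaches u
        in-A {i} {u} u∈I l = u , subst (_∈ A) (sym (layer∩J initial l u∈I)) (a∈A i) , ε

      -- Built from its far end, so that the prefixes of a walk are its structural subterms.
      data Walk (b : V) : Fin n → V → Set where
        start : ∀ {i w} → Pendant (γ i) b → Layer (next i) w → ¬ E b w → Walk b (next i) w
        _▹_   : ∀ {i u w} → Walk b i u → Layer (next i) w × ¬ E u w → Walk b (next i) w

      walk-layer : ∀ {b i w} → Walk b i w → Layer i w
      walk-layer (start _ l _)  = l
      walk-layer (_ ▹ (l , _)) = l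

      -- Vertices of layers have two neighbours in `B`, so past its first arc a path only uses arcs
      -- between layers, and the layer index advances by one each time.
      extend : ∀ {b i u t} → Walk b i u → Star Step u t → ∃ λ j → Walk b j t
      extend W ε = _ , W
      extend W (inj₁ (i , l , m , ≁) ◅ path) with refl ← layer-unique (walk-layer W) l = extend (W ▹ (m , ≁)) path
      extend W (inj₂ (_ , (N₁ , _) , _) ◅ path) = ⊥-elim (layer-¬N₁ (walk-layer W) N₁)

      good-walk : ∀ {b t} → InN G 1 B b → t ∈ A → Star Step b t → ∃ λ j → Walk b j t
      good-walk N₁ t∈A ε with A⊆a t∈A
      ... | i , refl = ⊥-elim (layer-¬N₁ {i} refl N₁)
      good-walk N₁ t∈A (inj₁ (i , l , _) ◅ _) = ⊥-elim (layer-¬N₁ l N₁)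
      good-walk N₁ t∈A (inj₂ (i , Pb , l , ≁) ◅ path) =
        extend (start Pb (subst (λ j → Layer j _) (sym (next-prev i)) l) ≁) path

      -- From a walk to a resolving sequence.

      Resolvable : VSet G → Set
      Resolvable J = ∃ λ J′ → ∃ λ K → Star (InternalMove G B) J J′ × Move G J′ K × ¬ HasCycleIn G (K ∪ B)

      Occupies : VSet G → V → Set
      Occupies J v = ∃ λ J′ → InternalMove G B J J′ × Position J′ × v ∈ J′

      -- Quantified over the whole layer, so that it supplies the conditions on a claw leaf
      -- whichever vertex of that layer becomes another leaf.
      Far : V → Fin n → Set
      Far u i = ∀ {w} → Layer i w → ¬ E u w × u ≢ w

      -- Adjacent vertices lie in equal or consecutive layers, and `next²≢`, `next≢` and `next³≢`
      -- exclude each of these possibilities.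
      layer-far : ∀ {i u} → Layer i u → Far u (next (next i))
      layer-far {i} {u} l m = ≁ , λ { refl → next²≢ i (layer-unique m l) }
        where
        ≁ : ¬ E u _
        ≁ e with layers-nbr l m e
        ... | inj₁ eq = next²≢ i eq
        ... | inj₂ (inj₁ eq) = next≢ i (next-injective eq)
        ... | inj₂ (inj₂ eq) = next³≢ i (sym eq)

      pendant-far : ∀ {i b} → Pendant (γ i) b → Far b (next (next i))
      pendant-far {i} {b} Pb m = ≁ , λ eq → layer≢pendant m Pb (sym eq)
        where
        ≁ : ¬ E b _
        ≁ e with pendant-nbr m Pb e
        ... | inj₁ eq = next²≢ i eq
        ... | inj₂ eq = next≢ i (next-injective eq)

      -- Among the layers, `γ (prev i)` is seen only from `prev i` and `i`. It is the third leaf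
      -- with which `enter` begins the chain of claws.
      γ-prev-far : ∀ i → Far (γ (prev i)) (next i)
      γ-prev-far i m = ≁ , λ { refl → layer∉B m (γ∈B _) }
        where
        ≁ : ¬ E (γ (prev i)) _
        ≁ e with layer~γ-only m (E-sym e)
        ... | inj₁ eq = next²≢ i (sym (prev≡⇒≡next eq))
        ... | inj₂ eq = next≢ i (sym (prev-injective eq))

      module _ {b} (N[b]⊆A : (nbhd G b ∩ I) ⊆ A) where

        -- The vertex u will be the third leaf, beside w and its successor v on the walk, of a
        -- claw at x i that rules out E v (x i).
        record Blocked {J} (P : Position J) (i : Fin n) (w : V) : Set where
          open Position P
          field
            w~x      : E w (x i)
            w~x-next : E w (x (next i))
            w-far    : Far w (next (next i))
            u        : V
            u~x      : E u (x i)
            u≁w      : ¬ E u w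
            u≢w      : u ≢ w
            u-far    : Far u (next i)

        -- Besides `x k` no token touches `b`: those in layers by `only`, those outside `A` because
        -- N(b) ∩ I ⊆ A. The move is therefore legal, and `acyclic` applies to its result.
        leave : ∀ {J i k} (P : Position J) → Pendant (γ i) b → E b (Position.x P k) →
                (∀ {j} → E b (Position.x P j) → j ≡ k) → Resolvable J
        leave {J} {i} {k} P Pb b~x only =
          J , swap J (x k) b , ε , (x k , b , E-sym b~x , x∈J k , refl , ind) , acyclic P Pb ind
          where
          open Position P
          b≁ : ∀ {y} → y ∈ J → y ≢ x k → ¬ E b y
          b≁ y∈J y≢ by with cover y∈J
          ... | inj₁ (j , refl) = y≢ (cong x (only by))
          ... | inj₂ (y∈I , y∉A) = y∉A (N[b]⊆A (x∈p∩q⁺ (E⇒∈nbhd by , y∈I)))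
          ind : Independent G (swap J (x k) b)
          ind = swap-independent independent b≁

        -- By `γ-nbr`, `b` sees `x i` or `x (next i)`. If it sees just one, that token moves to `b`;
        -- if both, `b` blocks with `γ (prev i)` as the third leaf.
        enter : ∀ {J i} (P : Position J) → Pendant (γ i) b → Resolvable J ⊎ Blocked P i b
        enter {J} {i} P Pb with E? b (Position.x P i) | E? b (Position.x P (next i))
        ... | yes e | yes e′ = inj₂ (record
          { w~x = e ; w~x-next = e′ ; w-far = pendant-far Pb ; u = γ (prev i)
          ; u~x = E-sym (layer~γ-prev (x∈layer i))
          ; u≁w = λ f → prev≢ i (pendant~γ-only Pb (E-sym f))
          ; u≢w = λ { refl → pendant∉B Pb (γ∈B _) }
          ; u-far = γ-prev-far i })
          where open Position P
        ... | yes e | no ¬e′ = inj₁ (leave P Pb e only)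
          where
          only : ∀ {j} → E b (Position.x P j) → j ≡ i
          only {j} f with pendant-nbr (Position.x∈layer P j) Pb f
          ... | inj₁ eq = eq
          ... | inj₂ refl = ⊥-elim (¬e′ f)
        ... | no ¬e | yes e′ = inj₁ (leave P Pb e′ only)
          where
          only : ∀ {j} → E b (Position.x P j) → j ≡ next i
          only {j} f with pendant-nbr (Position.x∈layer P j) Pb f
          ... | inj₁ refl = ⊥-elim (¬e f)
          ... | inj₂ eq = eq
        ... | no ¬e | no ¬e′ with γ-nbr P (pendant~γ Pb)
        ...   | inj₁ eq = ⊥-elim (layer≢pendant (Position.x∈layer P i) Pb (sym eq))
        ...   | inj₂ (inj₁ eq) = ⊥-elim (layer≢pendant (Position.x∈layer P (next i)) Pb (sym eq))
        ...   | inj₂ (inj₂ (inj₁ e)) = ⊥-elim (¬e e)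
        ...   | inj₂ (inj₂ (inj₂ e)) = ⊥-elim (¬e′ e)

        module _ {J i w v} (P : Position J) (blocked : Blocked P i w)
                 (l : Layer (next i) v) (w≁v : ¬ E w v) (w≢v : w ≢ v) where
          open Position P
          open Blocked blocked

          v≁x : ¬ E v (x i)
          v≁x e = claw-free (x i) u w v (E-sym u~x) (E-sym w~x) (E-sym e)
                    u≢w (proj₂ (u-far l)) w≢v u≁w (proj₁ (u-far l)) w≁v

          -- As a vertex of layer `next i`, `v` sees `γ i`, and `γ-nbr` leaves four cases. Being
          -- `x i` contradicts its layer, being `x (next i)` contradicts `w≁v`, and seeing `x i`
          -- gives the claw of `v≁x`.
          v~x-next : E v (x (next i))
          v~x-next with γ-nbr P {i} (subst (λ j → E v (γ j)) (prev-next i) (layer~γ-prev l))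
          ... | inj₁ refl = ⊥-elim (next≢ i (layer-unique l (x∈layer i)))
          ... | inj₂ (inj₁ refl) = ⊥-elim (w≁v w~x-next)
          ... | inj₂ (inj₂ (inj₁ e)) = ⊥-elim (v≁x e)
          ... | inj₂ (inj₂ (inj₂ e)) = e

          -- If `v` also sees the token of the following layer, it blocks in turn, with `w` as the
          -- new third leaf. If not, the token of its own layer is its only neighbour among the
          -- tokens and can slide to it.
          advance : Occupies J v ⊎ Blocked P (next i) v
          advance with E? v (x (next (next i)))
          ... | yes e = inj₂ (record
            { w~x = v~x-next ; w~x-next = e ; w-far = layer-far l ; u = w
            ; u~x = w~x-next ; u≁w = w≁v ; u≢w = w≢v ; u-far = w-far })
          ... | no ¬e = inj₁ (swap J (x (next i)) v
            , (x (next i) , v , E-sym v~x-next , x∈J _ , refl , ind , layer-N₂ (x∈layer _) , layer-N₂ l)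
            , move-layer P l ind , ∈-swap-new {J} {x (next i)})
            where
            v≁ : ∀ {y} → y ∈ J → y ≢ x (next i) → ¬ E v y
            v≁ y∈J y≢ vy with cover y∈J
            ... | inj₂ (y∈I , y∉A) = layer≁fixed l y∈I y∉A vy
            ... | inj₁ (j , refl) with layers-nbr l (x∈layer j) vy
            ...   | inj₁ refl = y≢ refl
            ...   | inj₂ (inj₁ refl) = ¬e vy
            ...   | inj₂ (inj₂ eq) with refl ← next-injective eq = v≁x vy
            ind : Independent G (swap J (x (next i)) v)
            ind = swap-independent independent v≁

        -- Scanning the walk from b, the first vertex that does not block can be moved to, and then
        -- ends a shorter walk.  It exists: the last vertex holds a token that its predecessor misses.
        mutual
          resolve : ∀ {J i w} → Walk b i w → (P : Position J) → w ∈ J → Resolvable J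
          resolve (start Pb l b≁w) P w∈J with enter P Pb
          ... | inj₁ r = r
          ... | inj₂ blocked = ⊥-elim (b≁w (subst (E b) (sym (layer∩J P l w∈J)) (Blocked.w~x-next blocked)))
          resolve (W ▹ (l , u≁w)) P w∈J with scan W P
          ... | inj₁ r = r
          ... | inj₂ blocked = ⊥-elim (u≁w (subst (E _) (sym (layer∩J P l w∈J)) (Blocked.w~x-next blocked)))

          scan : ∀ {J i w} → Walk b i w → (P : Position J) → Resolvable J ⊎ Blocked P i w
          scan W P = [ inj₁ , go W ]′ (attempt W P)

          attempt : ∀ {J i w} → Walk b i w → (P : Position J) → Resolvable J ⊎ (Occupies J w ⊎ Blocked P i w)
          attempt (start Pb l b≁w) P with enter P Pb
          ... | inj₁ r = inj₁ r
          ... | inj₂ blocked = inj₂ (advance P blocked l b≁w (λ eq → layer≢pendant l Pb (sym eq)))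
          attempt (W ▹ (l , u≁w)) P with scan W P
          ... | inj₁ r = inj₁ r
          ... | inj₂ blocked = inj₂ (advance P blocked l u≁w
                  (λ { refl → next≢ _ (layer-unique l (walk-layer W)) }))

          go : ∀ {J i w} {P : Position J} → Walk b i w →
               Occupies J w ⊎ Blocked P i w →
               Resolvable J ⊎ Blocked P i w
          go W (inj₂ blocked) = inj₂ blocked
          -- The position has changed, so the search starts again on the walk ending at `w`.
          -- Recursion is well-founded because every cycle of calls passes through `resolve` or
          -- `attempt`, where the walk loses its last step.
          go W (inj₁ (J′ , move , P′ , w∈J′)) with resolve W P′ w∈J′
          ... | J″ , K , moves , rest = inj₁ (J″ , K , move ◅ moves , rest)

      good-path⇒resolvable : GoodPath → Resolvable I
      good-path⇒resolvable (b , N₁ , N[b]⊆A , t , t∈A , path) =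
        resolve N[b]⊆A (proj₂ (good-walk N₁ t∈A path)) initial (A⊆I t∈A)

    -- From a resolving sequence to a directed path.

    module _ (F : Frame)
             (cycle : LayersCyclic) where
      open Frame F
      open WithFrame F
      module Reversed = WithFrame (reverse F)

      -- Excludes resolving sequences consisting of internal moves alone, the empty one included.
      positions-cyclic : ∀ {J} → Star (InternalMove G B) I J → HasCycleIn G (J ∪ B)
      positions-cyclic moves = cyclic-layers (proj₁ (reached moves)) cycle

      resolvable⇒good-path : Resolvable I → GoodPath ⊎ Reversed.GoodPath
      resolvable⇒good-path (J , _ , moves , (u , v , uv , u∈J , refl , ind) , acyc) = from-token (cover u∈J)
        where
        P : Position J
        P = proj₁ (reached moves)
        open Position P

        v∈K : v ∈ swap J u v
        v∈K = ∈-swap-new {J} {u}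

        from-token : (∃ λ i → u ≡ x i) ⊎ (u ∈ I × u ∉ A) → GoodPath ⊎ Reversed.GoodPath
        -- Moving a token outside `A` leaves all layers occupied, so a cycle remains.
        from-token (inj₂ (u∈I , u∉A)) = ⊥-elim (acyc (cycle x x∈layer
          (λ i → ∈-swap-old (x∈J i) (layer≢fixed (x∈layer i) u∈I u∉A))))
        from-token (inj₁ (i , refl)) = by-nbrs (layer-nbr (x∈layer i) uv v∉B)
          where
          stays : ∀ {j} → j ≢ i → x j ∈ swap J (x i) v
          stays j≢i = ∈-swap-old (x∈J _) (j≢i ∘ x-injective P)

          v≁ : ∀ {j} → j ≢ i → ¬ E v (x j)
          v≁ j≢i = ind _ _ v∈K (stays j≢i)

          -- A `γ` that sees `x i` also sees the token of a neighbouring layer, and that token stays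
          -- in place.
          v∉B : v ∉ B
          v∉B v∈B with B⊆γ v∈B
          ... | j , refl with layer~γ-only (x∈layer i) uv
          ...   | inj₁ refl = v≁ (next≢ i) (E-sym (x~γ-next P i))
          ...   | inj₂ refl = v≁ (prev≢ i) (E-sym (layer~γ (x∈layer (prev i))))

          -- Seeing both would put `v` in layer `i`, and the result would again have one token per
          -- layer.
          ¬both : E v (γ i) → ¬ E v (γ (prev i))
          ¬both e e′ = acyc (cyclic-layers (move-layer P (layer-intro e e′ (move-γ P uv ind)) ind) cycle)

          N[v]⊆A : (nbhd G v ∩ I) ⊆ A
          N[v]⊆A {y} y∈ with x∈p∩q⁻ (nbhd G v) I y∈ | y ∈? A
          ... | _ | yes y∈A = y∈A
          ... | vy , y∈I | no y∉A = ⊥-elim (ind _ _ v∈K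
            (∈-swap-old (fixed y∈I y∉A) (λ eq → layer≢fixed (x∈layer i) y∈I y∉A (sym eq))) (∈nbhd⇒E vy))

          by-nbrs : E v (γ i) ⊎ E v (γ (prev i)) → GoodPath ⊎ Reversed.GoodPath
          -- The neighbour of `v` in `B` fixes the orientation: `γ i` gives an arc to the token of
          -- layer `next i`, whereas `γ (prev i)` gives one to that of layer `prev i`, an arc for
          -- the reversed cycle.
          by-nbrs (inj₁ e) = inj₁ (v , proj₁ Pv , N[v]⊆A ,
              step-reaches (inj₂ (next i , subst (λ j → Pendant (γ j) v) (sym (prev-next i)) Pv
                                 , x∈layer _ , v≁ (next≢ i)))
                           (proj₂ (reached moves) (x∈J _) (x∈layer (next i))))
            where
            only : ∀ {j} → E v (γ j) → j ≡ i
            only f with move-γ P uv ind f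
            ... | inj₁ eq = eq
            ... | inj₂ refl = ⊥-elim (¬both e f)
            Pv : Pendant (γ i) v
            Pv = pendant-intro v∉B e only
          by-nbrs (inj₂ e) = inj₂ (v , proj₁ Pv , N[v]⊆A ,
              Reversed.step-reaches
                (inj₂ (prev i , subst (λ j → Pendant (γ (prev j)) v) (sym (next-prev i)) Pv
                      , x∈layer _ , v≁ (prev≢ i)))
                (proj₂ (Reversed.reached moves) (x∈J _) (x∈layer (prev i))))
            where
            only : ∀ {j} → E v (γ j) → j ≡ prev i
            only f with move-γ P uv ind f
            ... | inj₁ refl = ⊥-elim (¬both f e)
            ... | inj₂ eq = eq
            Pv : Pendant (γ (prev i)) v
            Pv = pendant-intro v∉B e only

-- The frame of the given cycle.

module _ (G : Graph) where

  ∈-cycleVerts⁺ : ∀ k c {j} → j < k → c j ∈ cycleVerts G k c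
  ∈-cycleVerts⁺ k c {j} j<k = ∈-⋃-map⁺ (λ i → ⁅ c i ⁆) (∈-upTo⁺ j<k) (x∈⁅x⁆ (c j))

  ∈-cycleVerts⁻ : ∀ k c {v} → v ∈ cycleVerts G k c → ∃ λ j → j < k × v ≡ c j
  ∈-cycleVerts⁻ k c v∈ with ∈-⋃-map⁻ (λ i → ⁅ c i ⁆) (List.upTo k) v∈
  ... | j , j∈ , v∈j = j , ∈-upTo⁻ j∈ , x∈⁅y⁆⇒x≡y (c j) v∈j

module Cycle (G : Graph) (claw-free : ClawFree G) (I : VSet G) (I-independent : Independent G I)
             (n : ℕ) (c : ℕ → Fin (Graph.N G)) (4≤n : 4 ≤ n) (bad : IsBad G I (2 * n) c)
             (c0∈I : c 0 ∈ I) where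
  open Tokens G

  A B : VSet G
  A = partA G I (2 * n) c
  B = partB G I (2 * n) c

  alternating : IsAlternating G I (2 * n) c
  alternating = proj₁ bad

  3≤2n : 3 ≤ 2 * n
  3≤2n = proj₁ (proj₁ (proj₂ bad))

  c-injective : ∀ {i j} → i < 2 * n → j < 2 * n → c i ≡ c j → i ≡ j
  c-injective = proj₁ (proj₂ (proj₁ (proj₂ bad))) _ _

  c-edge : ∀ {i} → i < 2 * n → E (c i) (c (wrap (2 * n) (suc i)))
  c-edge = proj₂ (proj₂ (proj₁ (proj₂ bad))) _

  chordless : ∀ {i j} → i < 2 * n → j < 2 * n → E (c i) (c j) →
              j ≡ wrap (2 * n) (suc i) ⊎ i ≡ wrap (2 * n) (suc j)
  chordless = proj₂ (proj₂ bad) _ _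

  mutual
    even∈I : ∀ {m} → m < n → c (2 * m) ∈ I
    even∈I {zero}  _    = c0∈I
    even∈I {suc m} sm<n with alternating (suc (2 * m)) (suc-double-< m<n)
      where m<n = ℕₚ.<-trans (ℕₚ.n<1+n m) sm<n
    ... | inj₁ (odd∈I , _) = ⊥-elim (odd∉I (ℕₚ.<-trans (ℕₚ.n<1+n m) sm<n) odd∈I)
    ... | inj₂ (_ , next∈I) = subst (λ j → c j ∈ I) (Succ-double (up sm<n)) next∈I

    odd∉I : ∀ {m} → m < n → c (suc (2 * m)) ∉ I
    odd∉I {m} m<n with alternating (2 * m) (double-< m<n)
    ... | inj₁ (_ , next∉I) = subst (λ j → c j ∉ I) (wrap-small (suc-double-< m<n)) next∉I
    ... | inj₂ (even∉I , _) = ⊥-elim (even∉I (even∈I m<n))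

  0<n : 0 < n
  0<n = ℕₚ.≤-trans (s≤s z≤n) 4≤n

  index : ℕ → Fin n
  index m = fromℕ< (wrap-< 0<n m)

  toℕ-index : ∀ m → toℕ (index m) ≡ wrap n m
  toℕ-index m = toℕ-fromℕ< _

  toℕ-index-< : ∀ {m} → m < n → toℕ (index m) ≡ m
  toℕ-index-< m<n = trans (toℕ-index _) (wrap-small m<n)

  index-toℕ : ∀ i → index (toℕ i) ≡ i
  index-toℕ i = toℕ-injective (toℕ-index-< (toℕ<n i))

  pred-mod : ℕ → ℕ
  pred-mod zero    = n ∸ 1
  pred-mod (suc m) = m

  next prev : Fin n → Fin n
  next i = index (suc (toℕ i))
  prev i = index (pred-mod (toℕ i))

  next-Succ : ∀ i → Succ n (toℕ i) (toℕ (next i))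
  next-Succ i = subst (Succ n (toℕ i)) (sym (toℕ-index _)) (wrap-suc (toℕ<n i))

  pred-mod-Succ : ∀ {m} → m < n → pred-mod m < n × Succ n (pred-mod m) m
  pred-mod-Succ {zero} _ = subst (_≤ n) (sym 1+[n∸1]) ℕₚ.≤-refl , around 1+[n∸1]
    where
    1+[n∸1] : suc (n ∸ 1) ≡ n
    1+[n∸1] = ℕₚ.m+[n∸m]≡n 0<n
  pred-mod-Succ {suc m} sm<n = ℕₚ.<-trans (ℕₚ.n<1+n m) sm<n , up sm<n

  prev-Succ : ∀ i → Succ n (toℕ (prev i)) (toℕ i)
  prev-Succ i with pred-mod-Succ (toℕ<n i)
  ... | <n , s = subst (λ m → Succ n m (toℕ i)) (sym (toℕ-index-< <n)) s

  next≡ : ∀ {i j} → Succ n (toℕ i) (toℕ j) → next i ≡ j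
  next≡ {i} s = toℕ-injective (Succ-functional (next-Succ i) s)

  prev≡ : ∀ {i j} → Succ n (toℕ j) (toℕ i) → prev i ≡ j
  prev≡ {i} s = toℕ-injective (Succ-injective (prev-Succ i) s)

  -- Climb from `i` to the last layer, step around to layer 0, then climb to `j`; this way `i` and
  -- `j` need not be compared.
  connected : (P : Fin n → Set) → (∀ i → P i → P (next i)) → ∀ i j → P i → P j
  connected P step i j Pi =
    subst P (index-toℕ j) (climb z≤n (toℕ<n j) (subst P (next≡ last-Succ) (step _ P-last)))
    where
    m = n ∸ 1
    sm≡n : suc m ≡ n
    sm≡n = ℕₚ.m+[n∸m]≡n 0<n
    m<n : m < n
    m<n = subst (m <_) sm≡n (ℕₚ.n<1+n m)
    climb : ∀ {k l} → k ≤ l → l < n → P (index k) → P (index l)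
    climb {k} {l} k≤l l<n Pk with ℕₚ.m≤n⇒m<n∨m≡n k≤l
    ... | inj₂ refl = Pk
    climb {k} {suc l} k≤l sl<n Pk | inj₁ (s≤s k≤l′) =
      subst P (next≡ (subst₂ (Succ n) (sym (toℕ-index-< l<n)) (sym (toℕ-index-< sl<n)) (up sl<n)))
        (step _ (climb k≤l′ l<n Pk))
      where l<n = ℕₚ.<-trans (ℕₚ.n<1+n l) sl<n
    P-last : P (index m)
    P-last = climb (ℕₚ.≤-pred (subst (toℕ i <_) (sym sm≡n) (toℕ<n i))) m<n
                   (subst P (sym (index-toℕ i)) Pi)
    last-Succ : Succ n (toℕ (index m)) (toℕ (index 0))
    last-Succ = subst₂ (Succ n) (sym (toℕ-index-< m<n)) (sym (toℕ-index-< 0<n)) (around sm≡n)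

  a γ : Fin n → V
  a i = c (2 * toℕ i)
  γ i = c (suc (2 * toℕ i))

  2i<2n : (i : Fin n) → 2 * toℕ i < 2 * n
  2i<2n i = double-< (toℕ<n i)

  1+2i<2n : (i : Fin n) → suc (2 * toℕ i) < 2 * n
  1+2i<2n i = suc-double-< (toℕ<n i)

  data Parity : ℕ → Set where
    even : (i : Fin n) → Parity (2 * toℕ i)
    odd  : (i : Fin n) → Parity (suc (2 * toℕ i))

  parity : ∀ {j} → j < 2 * n → Parity j
  parity {j} j<2n with half j
  ... | m , inj₁ refl = subst (λ k → Parity (2 * k)) (toℕ-index-< m<n) (even (index m))
    where m<n = double-<⁻ j<2n
  ... | m , inj₂ refl = subst (λ k → Parity (suc (2 * k))) (toℕ-index-< m<n) (odd (index m))
    where m<n = double-<⁻ (ℕₚ.<-trans (ℕₚ.n<1+n _) j<2n)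

  a∈A : ∀ i → a i ∈ A
  a∈A i = x∈p∩q⁺ (∈-cycleVerts⁺ G (2 * n) c (2i<2n i) , even∈I (toℕ<n i))

  A⊆a : ∀ {v} → v ∈ A → ∃ λ i → v ≡ a i
  A⊆a v∈A with x∈p∩q⁻ _ I v∈A
  ... | v∈C , v∈I with ∈-cycleVerts⁻ G (2 * n) c v∈C
  ... | j , j<2n , refl with parity j<2n
  ... | even i = i , refl
  ... | odd i = ⊥-elim (odd∉I (toℕ<n i) v∈I)

  γ∈B : ∀ i → γ i ∈ B
  γ∈B i = x∈p∧x∉q⇒x∈p─q (∈-cycleVerts⁺ G (2 * n) c (1+2i<2n i)) (odd∉I (toℕ<n i))

  I∩B≡∅ : ∀ {v} → v ∈ I → v ∉ B
  I∩B≡∅ v∈I v∈B = x∈p─q⇒x∉q _ I v∈B v∈I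

  B⊆γ : ∀ {v} → v ∈ B → ∃ λ i → v ≡ γ i
  B⊆γ v∈B with ∈-cycleVerts⁻ G (2 * n) c (p─q⊆p _ I v∈B)
  ... | j , j<2n , refl with parity j<2n
  ... | even i = ⊥-elim (I∩B≡∅ (even∈I (toℕ<n i)) v∈B)
  ... | odd i = i , refl

  γ-injective : ∀ {i j} → γ i ≡ γ j → i ≡ j
  γ-injective {i} {j} eq =
    toℕ-injective (double-injective (ℕₚ.suc-injective (c-injective (1+2i<2n i) (1+2i<2n j) eq)))

  γ~a-next : ∀ i → E (γ i) (a (next i))
  γ~a-next i = subst (E (γ i) ∘ c) (Succ-double (next-Succ i)) (c-edge (1+2i<2n i))

  a~γ : ∀ i → E (a i) (γ i)
  a~γ i = subst (E (a i) ∘ c) (wrap-small (1+2i<2n i)) (c-edge (2i<2n i))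

  a~γ-prev : ∀ i → E (a i) (γ (prev i))
  a~γ-prev i = E-sym (subst (E (γ (prev i)) ∘ a) (next≡ (prev-Succ i)) (γ~a-next (prev i)))

  a~γ-only : ∀ {i j} → E (a i) (γ j) → j ≡ i ⊎ j ≡ prev i
  a~γ-only {i} {j} e with chordless (2i<2n i) (1+2i<2n j) e
  ... | inj₁ eq = inj₁ (toℕ-injective (double-injective (ℕₚ.suc-injective (trans eq (wrap-small (1+2i<2n i))))))
  ... | inj₂ eq = inj₂ (sym (prev≡ (subst (Succ n (toℕ j)) (sym next-j) (next-Succ j))))
    where
    next-j : toℕ i ≡ toℕ (next j)
    next-j = double-injective (trans eq (Succ-double (next-Succ j)))

  -- Chordlessness makes adjacent vertices of `C` consecutive, while the successor of an odd
  -- position is even, also around the end.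
  B-independent : Independent G B
  B-independent u v u∈B v∈B uv with B⊆γ u∈B | B⊆γ v∈B
  ... | i , refl | j , refl with chordless (1+2i<2n i) (1+2i<2n j) uv
  ... | inj₁ eq = ℕₚ.even≢odd (toℕ (next i)) (toℕ j) (sym (trans eq (Succ-double (next-Succ i))))
  ... | inj₂ eq = ℕₚ.even≢odd (toℕ (next j)) (toℕ i) (sym (trans eq (Succ-double (next-Succ j))))

  open Setting claw-free I A B I-independent B-independent I∩B≡∅ (p∩q⊆q _ I) a a∈A A⊆a

  frame : Frame
  frame = record
    { next = next ; prev = prev
    ; next-prev = λ i → next≡ (prev-Succ i) ; prev-next = λ i → prev≡ (next-Succ i)
    ; next≢ = λ i eq → Succ-irrefl 4≤n (subst (Succ n (toℕ i) ∘ toℕ) eq (next-Succ i))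
    ; next²≢ = λ i eq → Succ²-irrefl 4≤n (next-Succ i)
                          (subst (Succ n (toℕ (next i)) ∘ toℕ) eq (next-Succ (next i)))
    ; next³≢ = λ i eq → Succ³-irrefl 4≤n (next-Succ i) (next-Succ (next i))
                          (subst (Succ n (toℕ (next (next i))) ∘ toℕ) eq (next-Succ (next (next i))))
    ; connected = connected ; γ = γ ; γ-injective = γ-injective ; γ∈B = γ∈B ; B⊆γ = B⊆γ
    ; a~γ = a~γ ; a~γ-prev = a~γ-prev ; a~γ-only = a~γ-only }

  open WithFrame frame using (layer∉B; layer-unique; layer~γ; layer~γ-prev; good-path⇒resolvable)

  -- The cycle is `C` with each `a i` replaced by `x i`, which has the same neighbours in `B`.
  layers-cycle : LayersCyclic
  layers-cycle {K} x l x∈K = 2 * n , f , (3≤2n , inj , edge) , f∈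
    where
    f : ℕ → V
    f = interleave (x ∘ index) (γ ∘ index)

    f-even : ∀ i → f (2 * toℕ i) ≡ x i
    f-even i = trans (interleave-even (x ∘ index) (γ ∘ index) (toℕ i)) (cong x (index-toℕ i))

    f-odd : ∀ i → f (suc (2 * toℕ i)) ≡ γ i
    f-odd i = trans (interleave-odd (x ∘ index) (γ ∘ index) (toℕ i)) (cong γ (index-toℕ i))

    x≢γ : ∀ i j → x i ≢ γ j
    x≢γ i j eq = layer∉B {i} (l i) (subst (_∈ B) (sym eq) (γ∈B j))

    inj : ∀ i j → i < 2 * n → j < 2 * n → f i ≡ f j → i ≡ j
    inj i j i< j< eq with parity i< | parity j<
    ... | even k | even m = cong (λ q → 2 * toℕ q) (layer-unique {k} {m} (l k)
            (subst (Layer m) (sym (trans (sym (f-even k)) (trans eq (f-even m)))) (l m)))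
    ... | even k | odd m = ⊥-elim (x≢γ k m (trans (sym (f-even k)) (trans eq (f-odd m))))
    ... | odd k | even m = ⊥-elim (x≢γ m k (trans (sym (f-even m)) (trans (sym eq) (f-odd k))))
    ... | odd k | odd m = cong (λ q → suc (2 * toℕ q))
            (γ-injective {k} {m} (trans (sym (f-odd k)) (trans eq (f-odd m))))

    edge : ∀ i → i < 2 * n → E (f i) (f (wrap (2 * n) (suc i)))
    edge i i< with parity i<
    ... | even k rewrite wrap-small (1+2i<2n k) | f-even k | f-odd k = layer~γ {k} (l k)
    ... | odd k rewrite Succ-double (next-Succ k) | f-odd k | f-even (next k) =
      E-sym (subst (λ j → E (x (next k)) (γ j)) (prev≡ (next-Succ k)) (layer~γ-prev {next k} (l (next k))))

    f∈ : ∀ i → i < 2 * n → f i ∈ K ∪ B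
    f∈ i i< with parity i<
    ... | even k = x∈p∪q⁺ (inj₁ (subst (_∈ K) (sym (f-even k)) (x∈K k)))
    ... | odd k = x∈p∪q⁺ (inj₂ (subst (_∈ B) (sym (f-odd k)) (γ∈B k)))

  -- Translation between the numbered digraphs and the steps of a frame.

  -- ι translates the layer indices of the cycle d into those of F.
  module Labelling (F : Frame) (d : ℕ → V) (ι : ℕ → Fin n)
                   (B≡ : partB G I (2 * n) d ≡ B)
                   (d-a : ∀ {i} → i < n → d (2 * i) ≡ a (ι i))
                   (d-γ : ∀ {i} → i < n →
                          d (wrap (2 * n) (2 * i + 2 * n ∸ 1)) ≡ Frame.γ F (Frame.prev F (ι i)))
                   (ι-next : ∀ {i} → i < n → ι (wrap n (suc i)) ≡ Frame.next F (ι i))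
                   (ι-onto : ∀ j → ∃ λ i → i < n × ι i ≡ j) where
    open WithFrame F using (Step; GoodPath)

    InLayer≡ : ∀ {i v} → i < n → InLayer G I n d i v ≡ Layer (ι i) v
    InLayer≡ i<n rewrite B≡ | d-a i<n = refl

    InLayer-next≡ : ∀ {i v} → i < n → InLayer G I n d (wrap n (suc i)) v ≡ Layer (Frame.next F (ι i)) v
    InLayer-next≡ {i} {v} i<n = trans (InLayer≡ (wrap-< 0<n (suc i))) (cong (λ j → Layer j v) (ι-next i<n))

    Pendant≡ : ∀ {i u} → i < n →
      (InN G 1 (partB G I (2 * n) d) u
        × nbhd G u ∩ partB G I (2 * n) d ≡ ⁅ d (wrap (2 * n) (2 * i + 2 * n ∸ 1)) ⁆)
      ≡ Pendant (Frame.γ F (Frame.prev F (ι i))) u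
    Pendant≡ i<n rewrite B≡ | d-γ i<n = refl

    arc⇒step : ∀ {u v} → Arc G I n d u v → Step u v
    arc⇒step (inj₁ (i , i<n , l , m , ≁)) =
      inj₁ (ι i , subst id (InLayer≡ i<n) l , subst id (InLayer-next≡ i<n) m , ≁)
    arc⇒step (inj₂ (i , i<n , N₁ , eq , m , ≁)) =
      inj₂ (ι i , subst id (Pendant≡ i<n) (N₁ , eq) , subst id (InLayer≡ i<n) m , ≁)

    step⇒arc : ∀ {u v} → Step u v → Arc G I n d u v
    step⇒arc (inj₁ (j , l , m , ≁)) with ι-onto j
    ... | i , i<n , refl =
      inj₁ (i , i<n , subst id (sym (InLayer≡ i<n)) l , subst id (sym (InLayer-next≡ i<n)) m , ≁)
    step⇒arc (inj₂ (j , Pu , m , ≁)) with ι-onto j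
    ... | i , i<n , refl with subst id (sym (Pendant≡ i<n)) Pu
    ... | N₁ , eq = inj₂ (i , i<n , N₁ , eq , subst id (sym (InLayer≡ i<n)) m , ≁)

    from-HasGoodPath : HasGoodPath G I n c d → GoodPath
    from-HasGoodPath (b , t , N₁ , N[b]⊆A , t∈A , path) = b , N₁ , N[b]⊆A , t , t∈A , Star.map arc⇒step path

    to-HasGoodPath : GoodPath → HasGoodPath G I n c d
    to-HasGoodPath (b , N₁ , N[b]⊆A , t , t∈A , path) = b , t , N₁ , N[b]⊆A , t∈A , Star.map step⇒arc path

  wrap-pred-double : ∀ {i} → i < n → wrap (2 * n) (2 * i + 2 * n ∸ 1) ≡ suc (2 * pred-mod i)
  wrap-pred-double i<n with pred-mod-Succ i<n
  ... | m<n , s = Succ-double-pred m<n s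

  index-a : ∀ {i} → i < n → c (2 * i) ≡ a (index i)
  index-a i<n = cong (λ m → c (2 * m)) (sym (toℕ-index-< i<n))

  index-γ : ∀ {i} → i < n → c (wrap (2 * n) (2 * i + 2 * n ∸ 1)) ≡ γ (prev (index i))
  index-γ i<n = cong c (trans (wrap-pred-double i<n) (cong (λ m → suc (2 * m))
    (sym (trans (cong (toℕ ∘ index ∘ pred-mod) (toℕ-index-< i<n))
                (toℕ-index-< (proj₁ (pred-mod-Succ i<n)))))))

  index-next : ∀ {i} → i < n → index (wrap n (suc i)) ≡ next (index i)
  index-next {i} i<n = sym (next≡ (subst₂ (Succ n) (sym (toℕ-index-< i<n))
    (sym (toℕ-index-< (wrap-< 0<n (suc i)))) (wrap-suc i<n)))

  index-onto : ∀ j → ∃ λ i → i < n × index i ≡ j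
  index-onto j = toℕ j , toℕ<n j , index-toℕ j

  module Forward = Labelling frame c index refl index-a index-γ index-next index-onto

  reflect<n : ∀ i → reflect n i < n
  reflect<n i = wrap-< 0<n (n ∸ i)

  -- `Arc` computes its set `B` from the cycle it is given, so the reversed cycle has to yield the
  -- same set. Surjectivity of the relabelling comes from its being an involution.
  cycleVerts-rev : cycleVerts G (2 * n) (rev G n c) ≡ cycleVerts G (2 * n) c
  cycleVerts-rev = ⊆-antisym to from
    where
    0<2n = ℕₚ.≤-trans (s≤s z≤n) 3≤2n
    to : cycleVerts G (2 * n) (rev G n c) ⊆ cycleVerts G (2 * n) c
    to v∈ with ∈-cycleVerts⁻ G (2 * n) (rev G n c) v∈
    ... | j , _ , refl = ∈-cycleVerts⁺ G (2 * n) c (wrap-< 0<2n (2 * n ∸ j))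
    from : cycleVerts G (2 * n) c ⊆ cycleVerts G (2 * n) (rev G n c)
    from v∈ with ∈-cycleVerts⁻ G (2 * n) c v∈
    ... | j , j< , refl = subst (_∈ cycleVerts G (2 * n) (rev G n c)) (cong c (reflect-involutive j<))
      (∈-cycleVerts⁺ G (2 * n) (rev G n c) (wrap-< 0<2n (2 * n ∸ j)))

  reflected : ℕ → Fin n
  reflected i = index (reflect n i)

  toℕ-reflected : ∀ i → toℕ (reflected i) ≡ reflect n i
  toℕ-reflected i = toℕ-index-< (reflect<n i)

  reflected-a : ∀ {i} → i < n → rev G n c (2 * i) ≡ a (reflected i)
  reflected-a {i} i<n = cong c (trans (reflect-double i<n) (cong (2 *_) (sym (toℕ-reflected i))))

  -- The shape `γ (prev (next ...))` is that of the reversed frame, whose `γ` is `γ ∘ prev` and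
  -- whose `prev` is `next`.
  reflected-γ : ∀ {i} → i < n →
                rev G n c (wrap (2 * n) (2 * i + 2 * n ∸ 1)) ≡ γ (prev (next (reflected i)))
  reflected-γ {i} i<n with pred-mod-Succ i<n
  ... | m<n , s = trans
    (cong c (trans (cong (reflect (2 * n)) (wrap-pred-double i<n))
            (trans (reflect-double-pred m<n s) (cong (λ m → suc (2 * m)) (sym (toℕ-reflected i))))))
    (cong γ (sym (prev≡ (next-Succ (reflected i)))))

  reflected-next : ∀ {i} → i < n → reflected (wrap n (suc i)) ≡ prev (reflected i)
  reflected-next {i} i<n = sym (prev≡ (subst₂ (Succ n) (sym (toℕ-reflected (wrap n (suc i))))
    (sym (toℕ-reflected i)) (reflect-Succ 4≤n (wrap-suc i<n))))

  reflected-onto : ∀ j → ∃ λ i → i < n × reflected i ≡ j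
  reflected-onto j = reflect n (toℕ j) , reflect<n (toℕ j)
    , trans (cong index (reflect-involutive (toℕ<n j))) (index-toℕ j)

  module Backward = Labelling (reverse frame) (rev G n c) reflected (cong (_─ I) cycleVerts-rev)
    reflected-a reflected-γ reflected-next reflected-onto

  equivalence : InternallyResolvable G I n c ⇔ (HasGoodPath G I n c c ⊎ HasGoodPath G I n c (rev G n c))
  equivalence = mk⇔ to from
    where
    to : InternallyResolvable G I n c → HasGoodPath G I n c c ⊎ HasGoodPath G I n c (rev G n c)
    to (inj₁ (J , moves , acyc)) = ⊥-elim (acyc (positions-cyclic frame layers-cycle moves))
    to (inj₂ resolvable) with resolvable⇒good-path frame layers-cycle resolvable
    ... | inj₁ path = inj₁ (Forward.to-HasGoodPath path)
    ... | inj₂ path = inj₂ (Backward.to-HasGoodPath path)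
    from : HasGoodPath G I n c c ⊎ HasGoodPath G I n c (rev G n c) → InternallyResolvable G I n c
    from (inj₁ path) = inj₂ (good-path⇒resolvable (Forward.from-HasGoodPath path))
    from (inj₂ path) = inj₂ (WithFrame.good-path⇒resolvable (reverse frame) (Backward.from-HasGoodPath path))

theorem14 : (G : Graph) → ClawFree G →
    (I : Defs.VSet G) → Independent G I →
    (n : ℕ) → (c : ℕ → Fin (Graph.N G)) →
    4 ≤ n → IsBad G I (2 * n) c → c 0 ∈ I →
    InternallyResolvable G I n c ⇔ (HasGoodPath G I n c c ⊎ HasGoodPath G I n c (rev G n c))
theorem14 G claw-free I I-independent n c 4≤n bad c0∈I =
  Cycle.equivalence G claw-free I I-independent n c 4≤n bad c0∈I
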